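{- Let $T$ be a tree of order $n\ge 3$. Then $T$ is a perfect Roman domination stable tree if and only if $T\in \mathcal{T}$.
   Context: All graphs are finite, simple (no loops or multiple edges). A perfect Roman dominating function (PRDF) on a graph $G=(V,E)$ is a function $f:V\to\{0,1,2\}$ such that every vertex $u$ with $f(u)=0$ is adjacent to exactly one vertex $v$ with $f(v)=2$. Its weight is $w(f)=\sum_{u\in V}f(u)$, and the perfect Roman domination number $\gamma_R^p(G)$ is the minimum weight of a PRDF on $G$; a PRDF of weight $\gamma_R^p(G)$ is a $\gamma_R^p$-function of $G$. A graph $G$ is perfect Roman domination stable if $\gamma_R^p(G-v)=\gamma_R^p(G)$ for every vertex $v\in V(G)$. For a tree $T$, let $W(T)=\{u\in V(T): f(u)=0 \text{ for every } \gamma_R^p\text{ -function } f \text{ of } T\}$. The family $\mathcal{T}$ consists of all trees $T$ for which there is a sequence of trees $T_1,T_2,\ldots,T_k$ ($k\ge 1$) with $T_1=P_3$ (the path on 3 vertices), $T_k=T$, and, for each $1\le i<k$, $T_{i+1}$ is obtained from $T_i$ by the following Operation $\mathcal{O}_1$: choose a vertex $u\in W(T_i)$, add a new path $v_3v_2v_1$ (three new vertices) and the edge $uv_3$. -}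

module Defs where

open import Data.Nat using (ℕ; zero; suc; _+_; _≤_)
open import Data.Nat using (_≡ᵇ_)
open import Data.Bool using (Bool; true; false; _∧_; if_then_else_)
open import Data.Fin using (Fin; zero; suc; punchIn; _≟_)
open import Data.Fin.Permutation using (Permutation′; _⟨$⟩ʳ_)
open import Data.List using (List; []; _∷_; _∷ʳ_; length; _++_)
open import Data.List.Relation.Unary.Linked using (Linked)
open import Data.List.Relation.Unary.Unique.Propositional using (Unique)
open import Data.Product using (Σ; _×_; ∃)
open import Relation.Binary.PropositionalEquality using (_≡_)
open import Relation.Nullary.Decidable using (⌊_⌋)

Graph : ℕ → Set
Graph n = Fin n → Fin n → Bool

Adj : ∀ {n} → Graph n → Fin n → Fin n → Set
Adj G u v = G u v ≡ true

IsSimple : ∀ {n} → Graph n → Set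
IsSimple {n} G = (∀ u v → G u v ≡ G v u) × (∀ u → G u u ≡ false)

data Reach {n} (G : Graph n) : Fin n → Fin n → Set where
  here : ∀ {u} → Reach G u u
  step : ∀ {u v w} → Adj G u v → Reach G v w → Reach G u w

IsConnected : ∀ {n} → Graph n → Set
IsConnected {n} G = ∀ u v → Reach G u v

HasCycle : ∀ {n} → Graph n → Set
HasCycle {n} G = Σ (Fin n) λ x → Σ (List (Fin n)) λ vs →
  (2 ≤ length vs) × Unique (x ∷ vs) × Linked (Adj G) (x ∷ vs ∷ʳ x)

IsTree : ∀ {n} → Graph n → Set
IsTree G = IsSimple G × IsConnected G × (HasCycle G → Data.Empty.⊥)
  where import Data.Empty

Σᶠ : ∀ {n} → (Fin n → ℕ) → ℕ
Σᶠ {zero} f = 0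
Σᶠ {suc n} f = f zero + Σᶠ (λ i → f (suc i))

count : ∀ {n} → (Fin n → Bool) → ℕ
count p = Σᶠ (λ i → if p i then 1 else 0)

weight : ∀ {n} → (Fin n → ℕ) → ℕ
weight = Σᶠ

IsPRDF : ∀ {n} → Graph n → (Fin n → ℕ) → Set
IsPRDF G f = (∀ u → f u ≤ 2) ×
  (∀ u → f u ≡ 0 → count (λ v → G u v ∧ (f v ≡ᵇ 2)) ≡ 1)

IsγRp : ∀ {n} → Graph n → ℕ → Set
IsγRp {n} G k = (Σ (Fin n → ℕ) λ f → IsPRDF G f × weight f ≡ k) ×
  (∀ f → IsPRDF G f → k ≤ weight f)

IsγRpFun : ∀ {n} → Graph n → (Fin n → ℕ) → Set
IsγRpFun G f = IsPRDF G f × (∀ g → IsPRDF G g → weight f ≤ weight g)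

_─_ : ∀ {m} → Graph (suc m) → Fin (suc m) → Graph m
(G ─ v) i j = G (punchIn v i) (punchIn v j)

IsPRDStable : ∀ {m} → Graph (suc m) → Set
IsPRDStable G = ∀ v k → (IsγRp G k → IsγRp (G ─ v) k) × (IsγRp (G ─ v) k → IsγRp G k)

InW : ∀ {n} → Graph n → Fin n → Set
InW G u = ∀ f → IsγRpFun G f → f u ≡ 0

P3 : Graph 3
P3 zero (suc zero) = true
P3 (suc zero) zero = true
P3 (suc zero) (suc (suc zero)) = true
P3 (suc (suc zero)) (suc zero) = true
P3 _ _ = false

-- Operation O1: new vertices 0 = v3, 1 = v2, 2 = v1; old vertex i becomes suc (suc (suc i));
-- edges v3v2, v2v1, u v3.
O1 : ∀ {n} → Graph n → Fin n → Graph (3 + n)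
O1 G u zero (suc zero) = true
O1 G u (suc zero) zero = true
O1 G u (suc zero) (suc (suc zero)) = true
O1 G u (suc (suc zero)) (suc zero) = true
O1 G u zero (suc (suc (suc i))) = ⌊ u ≟ i ⌋
O1 G u (suc (suc (suc i))) zero = ⌊ u ≟ i ⌋
O1 G u (suc (suc (suc i))) (suc (suc (suc j))) = G i j
O1 G u _ _ = false

data Gen : (n : ℕ) → Graph n → Set where
  base : Gen 3 P3
  op   : ∀ {n G} → Gen n G → (u : Fin n) → InW G u → Gen (3 + n) (O1 G u)

_≅_ : ∀ {n} → Graph n → Graph n → Set
_≅_ {n} G H = Σ (Permutation′ n) λ σ → ∀ i j → H (σ ⟨$⟩ʳ i) (σ ⟨$⟩ʳ j) ≡ G i j

In𝒯 : ∀ {n} → Graph n → Set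
In𝒯 {n} T = Σ (Graph n) λ G → Gen n G × (G ≅ T)

{-# OPTIONS --safe #-}
module Submission where

-- A PRDF of G - v is a PRDF of G with value 1 at v, with that value left out. So G is stable iff, with k
-- the minimum weight, every PRDF that takes the value 1 weighs at least k + 1 and each vertex has the
-- value 1 in some PRDF of weight k + 1.
--
-- The operation preserves this, together with uniqueness of the minimum, by a direct comparison of a
-- PRDF of the larger tree with its restriction.
--
-- Conversely let f be a minimum PRDF of a stable tree; its values are 0 and 2. Replace f by another
-- function g on one branch at a vertex: only the vertex and its neighbour in the branch can be badly
-- dominated, and raising them to 1 gives a lower bound for the weight of g on the branch. Summed over
-- the branches this shows that a function with value 2 at a zero of f is too heavy, and then that every
-- v with f v = 2 has exactly two neighbours with value 0. Adjacent 2s are impossible, because a 2 with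
-- just one neighbouring 2 could be set to 0. So the tree is partitioned into copies of P₃ centred
-- at the 2s; one of them is pendant, and deleting it leaves a smaller stable tree.

open import Defs
open import Data.Nat using (ℕ; zero; suc; _+_; _≤_; _<_; _≡ᵇ_; z≤n; s≤s)
import Data.Nat as ℕ
open import Data.Nat.Properties hiding (_≟_; suc-injective)
import Data.Nat.Properties as ℕₚ
open import Data.Nat.Solver using (module +-*-Solver)
open import Data.Bool using (Bool; true; false; _∧_; if_then_else_)
import Data.Bool as Bool
open import Data.Fin using (Fin; zero; suc; punchIn; punchOut; _≟_)
open import Data.Fin.Properties using (punchInᵢ≢i; punchIn-punchOut; punchIn-injective; suc-injective; all?; any?)
open import Data.Fin.Permutation using (Permutation′; _⟨$⟩ʳ_; _⟨$⟩ˡ_; inverseˡ; inverseʳ; flip; lift₀; insert; insert-punchIn; _∘ₚ_)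
import Data.Fin.Permutation as Perm
open import Data.List using (List; []; _∷_; _∷ʳ_; map)
open import Data.List.Properties using (map-++; length-map)
open import Data.List.Relation.Unary.All using (All; []; _∷_)
open import Data.List.Relation.Unary.All.Properties using (¬Any⇒All¬)
open import Data.List.Relation.Unary.Any using (here; there)
open import Data.List.Relation.Unary.AllPairs using ([]; _∷_)
open import Data.List.Relation.Unary.Linked as Linked using (Linked; []; [-]; _∷_)
import Data.List.Relation.Unary.Linked.Properties as Linkedₚ
open import Data.List.Relation.Unary.Unique.Propositional using (Unique)
import Data.List.Relation.Unary.Unique.Propositional.Properties as Uniqueₚ
open import Data.List.Membership.Propositional using (_∈_; _∉_)
import Data.List.Membership.DecPropositional as DecMembership
open import Data.Product using (Σ; ∃; _×_; _,_; proj₁; proj₂)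
open import Data.Sum using (_⊎_; inj₁; inj₂; [_,_]′)
open import Data.Empty using (⊥; ⊥-elim)
open import Function using (_∘_; id; case_of_)
open import Relation.Nullary using (¬_; Dec; yes; no; does)
open import Relation.Nullary.Decidable using (_×-dec_; _→-dec_; _⊎-dec_; ¬?; ⌊_⌋; map′; decidable-stable)
open import Relation.Binary.PropositionalEquality
open import Algebra.Properties.CommutativeMonoid.Sum +-0-commutativeMonoid using (sum; ∑-distrib-+; ∑-comm; sum-remove; sum-permute; sum-cong-≗)
open +-*-Solver using (solve; _:=_; _:+_; con)

-- Sums

private variable
  n : ℕ
  G H : Graph n

Σᶠ≡sum : (f : Fin n → ℕ) → Σᶠ f ≡ sum f
Σᶠ≡sum {zero}  f = refl
Σᶠ≡sum {suc n} f = cong (f zero +_) (Σᶠ≡sum (f ∘ suc))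

Σᶠ-cong : {f g : Fin n → ℕ} → (∀ i → f i ≡ g i) → Σᶠ f ≡ Σᶠ g
Σᶠ-cong {f = f} {g} p = trans (Σᶠ≡sum f) (trans (sum-cong-≗ p) (sym (Σᶠ≡sum g)))

Σᶠ-+ : (f g : Fin n → ℕ) → Σᶠ (λ i → f i + g i) ≡ Σᶠ f + Σᶠ g
Σᶠ-+ f g = trans (Σᶠ≡sum (λ i → f i + g i)) (trans (∑-distrib-+ f g) (sym (cong₂ _+_ (Σᶠ≡sum f) (Σᶠ≡sum g))))

Σᶠ-mono : {f g : Fin n → ℕ} → (∀ i → f i ≤ g i) → Σᶠ f ≤ Σᶠ g
Σᶠ-mono {zero}  p = z≤n
Σᶠ-mono {suc n} p = +-mono-≤ (p zero) (Σᶠ-mono (p ∘ suc))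

Σᶠ-comm : ∀ {m} (f : Fin m → Fin n → ℕ) → Σᶠ (λ i → Σᶠ (f i)) ≡ Σᶠ (λ j → Σᶠ (λ i → f i j))
Σᶠ-comm f = trans (Σᶠ-cong (λ i → Σᶠ≡sum (f i))) (trans (Σᶠ≡sum (λ i → sum (f i))) (trans (∑-comm f)
  (sym (trans (Σᶠ-cong (λ j → Σᶠ≡sum (λ i → f i j))) (Σᶠ≡sum (λ j → sum (λ i → f i j)))))))

Σᶠ-permute : (f : Fin n → ℕ) (σ : Permutation′ n) → Σᶠ (λ i → f (σ ⟨$⟩ʳ i)) ≡ Σᶠ f
Σᶠ-permute f σ = trans (Σᶠ≡sum (λ i → f (σ ⟨$⟩ʳ i))) (trans (sym (sum-permute f σ)) (sym (Σᶠ≡sum f)))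

Σᶠ-remove : (i : Fin (suc n)) (f : Fin (suc n) → ℕ) → Σᶠ f ≡ f i + Σᶠ (f ∘ punchIn i)
Σᶠ-remove i f = trans (Σᶠ≡sum f) (trans (sum-remove {i = i} f) (cong (f i +_) (sym (Σᶠ≡sum (f ∘ punchIn i)))))

Σᶠ-zero : {f : Fin n → ℕ} → (∀ i → f i ≡ 0) → Σᶠ f ≡ 0
Σᶠ-zero {zero}  p = refl
Σᶠ-zero {suc n} p rewrite p zero = Σᶠ-zero (p ∘ suc)

Σᶠ≡0⇒ : {f : Fin n → ℕ} → Σᶠ f ≡ 0 → ∀ i → f i ≡ 0
Σᶠ≡0⇒ {f = f} e zero    = m+n≡0⇒m≡0 _ e
Σᶠ≡0⇒ {f = f} e (suc i) = Σᶠ≡0⇒ {f = f ∘ suc} (m+n≡0⇒n≡0 (f zero) e) i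

≟-refl : (p : Fin n) {A : Set} {x y : A} → (if does (p ≟ p) then x else y) ≡ x
≟-refl p with p ≟ p
... | yes _ = refl
... | no ¬r = ⊥-elim (¬r refl)

≟-neq : {p q : Fin n} {A : Set} {x y : A} → p ≢ q → (if does (p ≟ q) then x else y) ≡ y
≟-neq {p = p} {q} p≢q with p ≟ q
... | yes r = ⊥-elim (p≢q r)
... | no  _ = refl

at : Fin n → ℕ → Fin n → ℕ
at p a u = if does (u ≟ p) then a else 0

Σᶠ-at : (p : Fin n) (a : ℕ) → Σᶠ (at p a) ≡ a
Σᶠ-at {suc n} p a = trans (Σᶠ-remove p (at p a)) (trans (cong₂ _+_ (≟-refl p) (Σᶠ-zero (λ i → ≟-neq (punchInᵢ≢i p i)))) (+-identityʳ a))

upd : Fin n → ℕ → (Fin n → ℕ) → Fin n → ℕ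
upd p a f u = if does (u ≟ p) then a else f u

upd-same : (p : Fin n) {a : ℕ} {f : Fin n → ℕ} → upd p a f p ≡ a
upd-same p = ≟-refl p

upd-other : {p u : Fin n} {a : ℕ} {f : Fin n → ℕ} → u ≢ p → upd p a f u ≡ f u
upd-other = ≟-neq

-- The removed value is added on the left, so that no truncated subtraction occurs. Later weight
-- identities have the same form.
Σᶠ-upd : (p : Fin n) (a : ℕ) (f : Fin n → ℕ) → Σᶠ (upd p a f) + f p ≡ Σᶠ f + a
Σᶠ-upd p a f = begin
  Σᶠ (upd p a f) + f p                     ≡⟨ cong (Σᶠ (upd p a f) +_) (Σᶠ-at p (f p)) ⟨
  Σᶠ (upd p a f) + Σᶠ (at p (f p))         ≡⟨ Σᶠ-+ (upd p a f) (at p (f p)) ⟨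
  Σᶠ (λ u → upd p a f u + at p (f p) u)    ≡⟨ Σᶠ-cong pointwise ⟩
  Σᶠ (λ u → f u + at p a u)                ≡⟨ Σᶠ-+ f (at p a) ⟩
  Σᶠ f + Σᶠ (at p a)                       ≡⟨ cong (Σᶠ f +_) (Σᶠ-at p a) ⟩
  Σᶠ f + a                                 ∎
  where
  open ≡-Reasoning
  pointwise : ∀ u → upd p a f u + at p (f p) u ≡ f u + at p a u
  pointwise u with u ≟ p
  ... | yes refl = +-comm a (f p)
  ... | no  _    = refl

count-true : (p : Fin n → Bool) (v : Fin n) → p v ≡ true → count p ≢ 0
count-true p v pv c≡0 with Σᶠ≡0⇒ c≡0 v
... | e rewrite pv = case e of λ ()

count≡1⇒∃! : (p : Fin n → Bool) → count p ≡ 1 → ∃ λ v → p v ≡ true × (∀ w → p w ≡ true → w ≡ v)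
count≡1⇒∃! {suc n} p e with p zero in eq
... | true  = zero , eq , λ { zero _ → refl ; (suc w) pw → ⊥-elim (count-true (p ∘ suc) w pw (ℕₚ.suc-injective e)) }
... | false with count≡1⇒∃! (p ∘ suc) e
...   | v , pv , uniq = suc v , pv , λ { zero pw → case trans (sym eq) pw of λ () ; (suc w) pw → cong suc (uniq w pw) }

∃!⇒count≡1 : (p : Fin n → Bool) (v : Fin n) → p v ≡ true → (∀ w → p w ≡ true → w ≡ v) → count p ≡ 1
∃!⇒count≡1 p v pv uniq = trans (Σᶠ-cong pointwise) (Σᶠ-at v 1)
  where
  pointwise : ∀ i → (if p i then 1 else 0) ≡ at v 1 i
  pointwise i with i ≟ v
  ... | yes refl rewrite pv = refl
  ... | no i≢v with p i in eq
  ...   | true  = ⊥-elim (i≢v (uniq i eq))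
  ...   | false = refl

count≡2⇒ : (p : Fin n → Bool) → count p ≡ 2 →
  ∃ λ a → ∃ λ b → a ≢ b × p a ≡ true × p b ≡ true × (∀ w → p w ≡ true → w ≡ a ⊎ w ≡ b)
count≡2⇒ {suc n} p e with p zero in eq
... | true with count≡1⇒∃! (p ∘ suc) (ℕₚ.suc-injective e)
...   | v , pv , uniq = zero , suc v , (λ ()) , eq , pv ,
        λ { zero _ → inj₁ refl ; (suc w) pw → inj₂ (cong suc (uniq w pw)) }
count≡2⇒ {suc n} p e | false with count≡2⇒ (p ∘ suc) e
...   | a , b , a≢b , pa , pb , all = suc a , suc b , a≢b ∘ suc-injective , pa , pb ,
        λ { zero pw → case trans (sym eq) pw of λ ()
          ; (suc w) pw → [ inj₁ ∘ cong suc , inj₂ ∘ cong suc ]′ (all w pw) }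

-- Perfect Roman domination

∧-true : ∀ {a b} → a ∧ b ≡ true → a ≡ true × b ≡ true
∧-true {true} {true} _ = refl , refl

∧-intro : ∀ {a b} → a ≡ true → b ≡ true → a ∧ b ≡ true
∧-intro refl refl = refl

≡ᵇ-true : ∀ m {k} → (m ≡ᵇ k) ≡ true → m ≡ k
≡ᵇ-true m {k} e = ≡ᵇ⇒≡ m k (subst Bool.T (sym e) _)

true-≡ᵇ : ∀ {m k} → m ≡ k → (m ≡ᵇ k) ≡ true
true-≡ᵇ {zero}  refl = refl
true-≡ᵇ {suc m} refl = true-≡ᵇ {m} refl

-- The counting condition in the form of a unique witness, which can be carried between graphs
-- without handling sums.
Dominated : Graph n → (Fin n → ℕ) → Fin n → Set
Dominated G f u = ∃ λ v → (Adj G u v × f v ≡ 2) × (∀ w → Adj G u w → f w ≡ 2 → w ≡ v)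

PR : Graph n → (Fin n → ℕ) → Set
PR G f = (∀ u → f u ≤ 2) × (∀ u → f u ≡ 0 → Dominated G f u)

count⇒Dominated : (G : Graph n) {f : Fin n → ℕ} (u : Fin n) → count (λ v → G u v ∧ (f v ≡ᵇ 2)) ≡ 1 → Dominated G f u
count⇒Dominated G {f} u c with count≡1⇒∃! _ c
... | v , pv , uniq = v , (proj₁ (∧-true pv) , ≡ᵇ-true (f v) (proj₂ (∧-true pv))) ,
  λ w a e → uniq w (∧-intro a (true-≡ᵇ e))

Dominated⇒count : (G : Graph n) {f : Fin n → ℕ} (u : Fin n) → Dominated G f u → count (λ v → G u v ∧ (f v ≡ᵇ 2)) ≡ 1
Dominated⇒count G {f} u (v , (a , e) , uniq) = ∃!⇒count≡1 _ v (∧-intro a (true-≡ᵇ e))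
  λ w pw → uniq w (proj₁ (∧-true pw)) (≡ᵇ-true (f w) (proj₂ (∧-true pw)))

IsPRDF⇒PR : {f : Fin n → ℕ} → IsPRDF G f → PR G f
IsPRDF⇒PR {G = G} (b , d) = b , λ u e → count⇒Dominated G u (d u e)

PR⇒IsPRDF : {f : Fin n → ℕ} → PR G f → IsPRDF G f
PR⇒IsPRDF {G = G} (b , d) = b , λ u e → Dominated⇒count G u (d u e)

-- Stability stated inside `G`, without deletions: `one` bounds the number of each `G ─ v` from
-- below by that of `G`, and `ex` bounds it from above.
record Stab {n} (G : Graph n) : Set where
  field
    f   : Fin n → ℕ
    pr  : PR G f
    min : ∀ g → PR G g → Σᶠ f ≤ Σᶠ g
    one : ∀ g x → PR G g → g x ≡ 1 → Σᶠ f < Σᶠ g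
    ex  : ∀ x → ∃ λ h → PR G h × h x ≡ 1 × Σᶠ h ≡ suc (Σᶠ f)

-- Deleting v corresponds to the value 1 at v.

del-PR : ∀ {m} {G : Graph (suc m)} v {h} → h v ≡ 1 → PR G h → PR (G ─ v) (h ∘ punchIn v)
del-PR {G = G} v {h} hv (b , d) = b ∘ punchIn v , dom
  where
  dom : ∀ u → h (punchIn v u) ≡ 0 → Dominated (G ─ v) (h ∘ punchIn v) u
  dom u e with d (punchIn v u) e
  ... | z , (a , z2) , uniq with v ≟ z
  ...   | yes refl = case trans (sym hv) z2 of λ ()
  ...   | no v≢z rewrite sym (punchIn-punchOut v≢z) = punchOut v≢z , (a , z2) ,
            λ w aw w2 → punchIn-injective v _ _ (uniq _ aw w2)

ins : ∀ {m} → Fin (suc m) → (Fin m → ℕ) → Fin (suc m) → ℕ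
ins v h u with v ≟ u
... | yes _ = 1
... | no ne = h (punchOut ne)

ins-same : ∀ {m} (v : Fin (suc m)) h → ins v h v ≡ 1
ins-same v h with v ≟ v
... | yes _ = refl
... | no ne = ⊥-elim (ne refl)

ins-punchIn : ∀ {m} (v : Fin (suc m)) h u → ins v h (punchIn v u) ≡ h u
ins-punchIn v h u with v ≟ punchIn v u
... | yes e = ⊥-elim (punchInᵢ≢i v u (sym e))
... | no ne = cong h (punchIn-injective v _ _ (punchIn-punchOut ne))

ins-weight : ∀ {m} (v : Fin (suc m)) h → Σᶠ (ins v h) ≡ suc (Σᶠ h)
ins-weight v h = trans (Σᶠ-remove v (ins v h)) (cong₂ _+_ (ins-same v h) (Σᶠ-cong (ins-punchIn v h)))

punched : ∀ {m} (v : Fin (suc m)) (P : Fin (suc m) → Set) → P v → (∀ u → P (punchIn v u)) → ∀ u → P u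
punched v P pv pu u with v ≟ u
... | yes refl = pv
... | no ne = subst P (punchIn-punchOut ne) (pu _)

ins-PR : ∀ {m} {G : Graph (suc m)} v {h} → PR (G ─ v) h → PR G (ins v h)
ins-PR {G = G} v {h} (b , d) = punched v _ (≤-trans (≤-reflexive (ins-same v h)) (s≤s z≤n))
    (λ u → ≤-trans (≤-reflexive (ins-punchIn v h u)) (b u)) ,
  punched v _ (λ e → case trans (sym e) (ins-same v h) of λ ()) dom
  where
  dom : ∀ u → ins v h (punchIn v u) ≡ 0 → Dominated G (ins v h) (punchIn v u)
  dom u e with d u (trans (sym (ins-punchIn v h u)) e)
  ... | z , (a , z2) , uniq = punchIn v z , (a , trans (ins-punchIn v h z) z2) ,
    punched v _ (λ _ e′ → case trans (sym e′) (ins-same v h) of λ ())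
      λ w aw w2 → cong (punchIn v) (uniq w aw (trans (sym (ins-punchIn v h w)) w2))

IsγRp-unique : {j k : ℕ} → IsγRp G j → IsγRp G k → j ≡ k
IsγRp-unique ((f , fp , refl) , mf) ((g , gp , refl) , mg) = ≤-antisym (mf g gp) (mg f fp)

Stab⇒stable : ∀ {m} {G : Graph (suc m)} → Stab G → IsPRDStable G
Stab⇒stable {G = G} S v k =
  (λ γ → subst (IsγRp (G ─ v)) (IsγRp-unique {G = G} γG γ) γDel) ,
  (λ γ → subst (IsγRp G) (IsγRp-unique {G = G ─ v} γDel γ) γG)
  where
  open Stab S
  γG : IsγRp G (Σᶠ f)
  γG = (f , PR⇒IsPRDF pr , refl) , λ g gp → min g (IsPRDF⇒PR gp)
  γDel : IsγRp (G ─ v) (Σᶠ f)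
  γDel with ex v
  ... | h , hp , hv , hw =
    (h ∘ punchIn v , PR⇒IsPRDF (del-PR {G = G} v hv hp) ,
      ℕₚ.suc-injective (trans (cong (_+ Σᶠ (h ∘ punchIn v)) (sym hv)) (trans (sym (Σᶠ-remove v h)) hw))) ,
    λ g gp → ℕ.s≤s⁻¹ (≤-trans (one (ins v g) v (ins-PR {G = G} v (IsPRDF⇒PR gp)) (ins-same v g)) (≤-reflexive (ins-weight v g)))

-- Existence of a minimum, by exhaustive search

infixr 5 _▸_
_▸_ : ℕ → (Fin n → ℕ) → Fin (suc n) → ℕ
(a ▸ f) zero    = a
(a ▸ f) (suc i) = f i

Bounded : (Fin n → ℕ) → Set
Bounded f = ∀ i → f i ≤ 2

-- Candidates are built value by value. They represent all bounded functions only up to pointwise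
-- equality, so `P` is required to respect it.
search : ∀ n (P : (Fin n → ℕ) → Set) → (∀ {f g} → (∀ i → f i ≡ g i) → P f → P g) →
  (∀ f → Dec (P f)) → Dec (∃ λ f → Bounded f × P f)
search zero P ext P? = map′ (λ p → empty , (λ ()) , p) (λ (f , _ , p) → ext {f} {empty} (λ ()) p) (P? empty)
  where
  empty : Fin 0 → ℕ
  empty ()
search (suc n) P ext P? = map′ to from (with-head 0 ⊎-dec with-head 1 ⊎-dec with-head 2)
  where
  Q : ℕ → Set
  Q a = ∃ λ f → Bounded f × P (a ▸ f)
  with-head : ∀ a → Dec (Q a)
  with-head a = search n (λ f → P (a ▸ f)) (λ e → ext (λ { zero → refl ; (suc i) → e i })) (λ f → P? _)
  put : ∀ a → a ≤ 2 → Q a → ∃ λ f → Bounded f × P f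
  put a a≤2 (f , b , p) = a ▸ f , (λ { zero → a≤2 ; (suc i) → b i }) , p
  to : Q 0 ⊎ Q 1 ⊎ Q 2 → ∃ λ f → Bounded f × P f
  to (inj₁ q)        = put 0 z≤n q
  to (inj₂ (inj₁ q)) = put 1 (s≤s z≤n) q
  to (inj₂ (inj₂ q)) = put 2 (s≤s (s≤s z≤n)) q
  take : ∀ f {a} → Bounded f → P f → f zero ≡ a → Q a
  take f b p e = f ∘ suc , b ∘ suc , ext (λ { zero → e ; (suc i) → refl }) p
  from : (∃ λ f → Bounded f × P f) → Q 0 ⊎ Q 1 ⊎ Q 2
  from (f , b , p) with f zero in e | b zero
  ... | 0 | _ = inj₁ (take f b p e)
  ... | 1 | _ = inj₂ (inj₁ (take f b p e))
  ... | 2 | _ = inj₂ (inj₂ (take f b p e))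
  ... | suc (suc (suc _)) | s≤s (s≤s ())

-- The constant 2 has no zeros and so is a PRDF. From there a lighter one is taken as long as there
-- is any; `K` bounds the weight and decreases.
minimum : (G : Graph n) → ∃ λ f → IsγRpFun G f
minimum {n} G = descend (Σᶠ twos) twos ((λ _ → s≤s (s≤s z≤n)) , λ _ ()) ≤-refl
  where
  twos : Fin n → ℕ
  twos _ = 2
  Below : ℕ → (Fin n → ℕ) → Set
  Below k f = (∀ u → f u ≡ 0 → count (λ v → G u v ∧ (f v ≡ᵇ 2)) ≡ 1) × Σᶠ f < k
  ext : ∀ k {f g} → (∀ i → f i ≡ g i) → Below k f → Below k g
  ext k e (d , l) = (λ u gu → trans (Σᶠ-cong (λ v → cong (λ a → if G u v ∧ (a ≡ᵇ 2) then 1 else 0) (sym (e v)))) (d u (trans (e u) gu))) ,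
    ≤-<-trans (≤-reflexive (Σᶠ-cong (sym ∘ e))) l
  below? : ∀ k f → Dec (Below k f)
  below? k f = all? (λ u → (f u ℕ.≟ 0) →-dec (count (λ v → G u v ∧ (f v ≡ᵇ 2)) ℕ.≟ 1)) ×-dec (Σᶠ f <? k)
  descend : ∀ K f → IsPRDF G f → Σᶠ f ≤ K → ∃ λ f → IsγRpFun G f
  descend K f fp l with search n (Below (Σᶠ f)) (ext _) (below? _)
  descend K f fp l | no ¬q = f , fp , λ g (b , d) → ≮⇒≥ λ lt → ¬q (g , b , d , lt)
  descend zero f fp l | yes (g , b , d , lt) = case <-≤-trans lt l of λ ()
  descend (suc K) f fp l | yes (g , b , d , lt) = descend K g (b , d) (ℕ.s≤s⁻¹ (<-≤-trans lt l))

-- The hypothesis only transfers a number already known to be the minimum for `G`, so the proof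
-- starts from a minimum PRDF found by search.
stable⇒Stab : ∀ {m} {G : Graph (suc m)} → IsPRDStable G → Stab G
stable⇒Stab {G = G} st with minimum G
... | f , fp , fmin = record
  { f = f ; pr = IsPRDF⇒PR fp ; min = λ g gp → fmin g (PR⇒IsPRDF gp)
  ; one = λ g x gp gx → ≤-trans (s≤s (proj₂ (γDel x) _ (PR⇒IsPRDF (del-PR {G = G} x gx gp))))
      (≤-reflexive (sym (trans (Σᶠ-remove x g) (cong (_+ Σᶠ (g ∘ punchIn x)) gx))))
  ; ex = λ x → let (h , hp , hw) = proj₁ (γDel x) in
      ins x h , ins-PR {G = G} x (IsPRDF⇒PR hp) , ins-same x h , trans (ins-weight x h) (cong suc hw)
  }
  where
  γDel : ∀ v → IsγRp (G ─ v) (Σᶠ f)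
  γDel v = proj₁ (st v (Σᶠ f)) ((f , fp , refl) , fmin)

-- Isomorphism

≅-sym : G ≅ H → H ≅ G
≅-sym {H = H} (σ , e) = flip σ , λ i j → trans (sym (e _ _)) (cong₂ H (inverseʳ σ) (inverseʳ σ))

≅-PR : {f : Fin n → ℕ} ((σ , _) : G ≅ H) → PR H f → PR G (f ∘ (σ ⟨$⟩ʳ_))
≅-PR {G = G} {H} {f} (σ , e) (b , d) = b ∘ _ , dom
  where
  dom : ∀ u → f (σ ⟨$⟩ʳ u) ≡ 0 → Dominated G (f ∘ (σ ⟨$⟩ʳ_)) u
  dom u fu with d _ fu
  ... | v , (a , v2) , uniq = σ ⟨$⟩ˡ v , (trans (sym (e _ _)) (trans (cong (H _) (inverseʳ σ)) a) , trans (cong f (inverseʳ σ)) v2) ,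
    λ w aw w2 → trans (sym (inverseˡ σ)) (cong (σ ⟨$⟩ˡ_) (uniq _ (trans (e u w) aw) w2))

≅-Stab : G ≅ H → Stab G → Stab H
≅-Stab {G = G} {H} i@(σ , _) S = record
  { f = f ∘ τ
  ; pr = ≅-PR (≅-sym {G = G} i) pr
  ; min = λ g gp → subst₂ _≤_ (sym wf) (Σᶠ-permute g σ) (min _ (≅-PR i gp))
  ; one = λ g x gp gx → subst₂ _<_ (sym wf) (Σᶠ-permute g σ) (one _ (τ x) (≅-PR i gp) (trans (cong g (inverseʳ σ)) gx))
  ; ex = λ x → let (h , hp , hx , hw) = ex (τ x) in
      h ∘ τ , ≅-PR (≅-sym {G = G} i) hp , hx , trans (Σᶠ-permute h (flip σ)) (trans hw (cong suc (sym wf)))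
  }
  where
  open Stab S
  τ = σ ⟨$⟩ˡ_
  wf : Σᶠ (f ∘ τ) ≡ Σᶠ f
  wf = Σᶠ-permute f (flip σ)

-- The operation O₁

-- Neither the old value 0 nor the new value 1 at `p` dominates anything, so the set of vertices
-- with value 2 stays the same.
upd-dominated : {f : Fin n → ℕ} {p x : Fin n} → f p ≡ 0 → Dominated G f x → Dominated G (upd p 1 f) x
upd-dominated {f = f} {p} fp (v , (a , v2) , uniq) =
  v , (a , trans (upd-other {p = p} {a = 1} {f} (λ { refl → case trans (sym fp) v2 of λ () })) v2) , λ w aw w2 → uniq w aw (two w w2)
  where
  two : ∀ w → upd p 1 f w ≡ 2 → f w ≡ 2
  two w e with w ≟ p
  ... | yes _ = case e of λ ()
  ... | no  _ = e

upd-PR : {f : Fin n → ℕ} (p : Fin n) → Bounded f → (∀ x → x ≢ p → f x ≡ 0 → Dominated G f x) → f p ≡ 0 → PR G (upd p 1 f)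
upd-PR {G = G} {f} p b d fp = bnd , dom
  where
  bnd : Bounded (upd p 1 f)
  bnd x with x ≟ p
  ... | yes _ = s≤s z≤n
  ... | no  _ = b x
  dom : ∀ x → upd p 1 f x ≡ 0 → Dominated G (upd p 1 f) x
  dom x e with x ≟ p
  ... | yes _   = case e of λ ()
  ... | no  x≢p = upd-dominated {G = G} fp (d x x≢p e)

Σᶠ-raise : {f : Fin n → ℕ} (p : Fin n) → f p ≡ 0 → Σᶠ (upd p 1 f) ≡ suc (Σᶠ f)
Σᶠ-raise {f = f} p fp = begin
  Σᶠ (upd p 1 f)       ≡⟨ +-identityʳ _ ⟨
  Σᶠ (upd p 1 f) + 0   ≡⟨ cong (Σᶠ (upd p 1 f) +_) fp ⟨
  Σᶠ (upd p 1 f) + f p ≡⟨ Σᶠ-upd p 1 f ⟩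
  Σᶠ f + 1             ≡⟨ +-comm _ 1 ⟩
  suc (Σᶠ f)           ∎
  where open ≡-Reasoning

old : Fin n → Fin (3 + n)
old x = suc (suc (suc x))

≡-adj : {u i : Fin n} → ⌊ u ≟ i ⌋ ≡ true → i ≡ u
≡-adj {u = u} {i} e with u ≟ i
... | yes p = sym p

adj-refl : (u : Fin n) → ⌊ u ≟ u ⌋ ≡ true
adj-refl u with u ≟ u
... | yes _ = refl
... | no ne = ⊥-elim (ne refl)

module O₁ {n} (G : Graph n) (u : Fin n) where

  T : Graph (3 + n)
  T = O1 G u

  -- The only edge between old and new vertices joins `u` to v₃, so domination can be lost only at
  -- `u`, and only if v₃ has the value 2.
  restrict-dominated : ∀ {g x} → x ≢ u ⊎ g zero ≢ 2 → Dominated T g (old x) → Dominated G (g ∘ old) x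
  restrict-dominated c (suc (suc (suc v)) , (a , v2) , uniq) =
    v , (a , v2) , λ w aw w2 → suc-injective (suc-injective (suc-injective (uniq (old w) aw w2)))
  restrict-dominated (inj₁ x≢u) (zero , (a , v2) , uniq) = ⊥-elim (x≢u (≡-adj a))
  restrict-dominated (inj₂ g≢2) (zero , (a , v2) , uniq) = ⊥-elim (g≢2 v2)
  restrict-dominated c (suc zero , (() , v2) , uniq)
  restrict-dominated c (suc (suc zero) , (() , v2) , uniq)

  extend-dominated : ∀ {f x a b c} → x ≢ u ⊎ a ≢ 2 → Dominated G f x → Dominated T (a ▸ b ▸ c ▸ f) (old x)
  extend-dominated {f} {x} {a} {b} {c} cnd (v , (av , v2) , uniq) = old v , (av , v2) , only cnd
    where
    only : x ≢ u ⊎ a ≢ 2 → ∀ w → Adj T (old x) w → (a ▸ b ▸ c ▸ f) w ≡ 2 → w ≡ old v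
    only (inj₁ x≢u) zero aw w2 = ⊥-elim (x≢u (≡-adj aw))
    only (inj₂ a≢2) zero aw w2 = ⊥-elim (a≢2 w2)
    only _ (suc zero) ()
    only _ (suc (suc zero)) ()
    only _ (suc (suc (suc w))) aw w2 = cong old (uniq w aw w2)

  dominated₀ : ∀ {g} → Dominated T g zero → g (suc zero) ≡ 2 ⊎ g (old u) ≡ 2
  dominated₀ (suc zero , (a , v2) , _) = inj₁ v2
  dominated₀ {g} (suc (suc (suc i)) , (a , v2) , _) = inj₂ (subst (λ j → g (old j) ≡ 2) (≡-adj a) v2)

  dominated₁ : ∀ {g} → Dominated T g (suc zero) → g zero ≡ 2 ⊎ g (suc (suc zero)) ≡ 2
  dominated₁ (zero , (a , v2) , _) = inj₁ v2
  dominated₁ (suc (suc zero) , (a , v2) , _) = inj₂ v2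

  dominated₂ : ∀ {g} → Dominated T g (suc (suc zero)) → g (suc zero) ≡ 2
  dominated₂ (suc zero , (a , v2) , _) = v2

  path : (Fin (3 + n) → ℕ) → ℕ
  path g = g zero + (g (suc zero) + g (suc (suc zero)))

  Σᶠ-split : ∀ g → Σᶠ g ≡ path g + Σᶠ (g ∘ old)
  Σᶠ-split g = solve 4 (λ a b c s → a :+ (b :+ (c :+ s)) := a :+ (b :+ c) :+ s) refl
    (g zero) (g (suc zero)) (g (suc (suc zero))) (Σᶠ (g ∘ old))

  -- If v₁ has the value 0, then v₂ has 2; if v₂ has 0, one of v₁ and v₃ has 2; otherwise v₁ and v₂
  -- carry at least 1 each.
  path-≥2 : ∀ g → PR T g → 2 ≤ path g
  path-≥2 g (b , d) with g (suc (suc zero)) in e₂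
  ... | 0 rewrite dominated₂ (d _ e₂) = m≤n+m 2 (g zero)
  ... | suc c with g (suc zero) in e₁
  ...   | suc b′ = ≤-trans (subst (2 ≤_) (sym (+-suc (suc b′) c)) (s≤s (s≤s z≤n))) (m≤n+m _ (g zero))
  ...   | 0 with dominated₁ (d _ e₁)
  ...     | inj₁ e rewrite e = s≤s (s≤s z≤n)
  ...     | inj₂ e rewrite ℕₚ.suc-injective (trans (sym e₂) e) = m≤n+m 2 (g zero)

  -- Besides the 2 at v₃, either v₁ is positive or its zero forces a 2 at v₂.
  path-≥3 : ∀ g → PR T g → g zero ≡ 2 → 3 ≤ path g
  path-≥3 g (b , d) e₀ rewrite e₀ with g (suc (suc zero)) in e₂
  ... | suc c = s≤s (s≤s (≤-trans (s≤s z≤n) (m≤n+m (suc c) _)))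
  ... | 0 rewrite dominated₂ (d _ e₂) = s≤s (s≤s (s≤s z≤n))

  -- Other distributions of the weight 2 leave a zero undominated: v₃ in 0, 0, 2 and 0, 1, 1, v₂ in
  -- 1, 0, 1, v₁ in 1, 1, 0. The hypotheses exclude 2, 0, 0 and a dominator of v₃ at `u`.
  path-≡2 : ∀ g → PR T g → g (old u) ≢ 2 → g zero ≢ 2 → path g ≡ 2 →
    g zero ≡ 0 × g (suc zero) ≡ 2 × g (suc (suc zero)) ≡ 0
  path-≡2 g (b , d) u≢2 z≢2 w with g (suc (suc zero)) in e₂
  ... | 0 rewrite dominated₂ (d _ e₂) = +-cancelʳ-≡ 2 _ _ w , refl , refl
  ... | suc c with g (suc zero) in e₁
  ...   | 0 with dominated₁ (d _ e₁)
  ...     | inj₁ e = ⊥-elim (z≢2 e)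
  ...     | inj₂ e rewrite ℕₚ.suc-injective (trans (sym e₂) e)
            with dominated₀ (d _ (+-cancelʳ-≡ 2 _ _ w))
  ...       | inj₁ e′ = case trans (sym e₁) e′ of λ ()
  ...       | inj₂ e′ = ⊥-elim (u≢2 e′)
  path-≡2 g (b , d) u≢2 z≢2 w | suc c | suc b′
    with g zero in e₀
  ... | suc a = case subst (_≡ 2) (cong suc (trans (+-suc a _) (cong suc (trans (cong (a +_) (+-suc b′ c)) (+-suc a _))))) w of λ ()
  ... | 0 with dominated₀ (d _ e₀)
  ...   | inj₂ e′ = ⊥-elim (u≢2 e′)
  ...   | inj₁ e′ rewrite ℕₚ.suc-injective (trans (sym e₁) e′) = case w of λ ()

  restrict-bounded : ∀ {g} → PR T g → Bounded (g ∘ old)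
  restrict-bounded (b , _) x = b (old x)

  restrict-PR : ∀ {g} → PR T g → g zero ≢ 2 ⊎ g (old u) ≢ 0 → PR G (g ∘ old)
  restrict-PR p@(b , d) (inj₁ c) = restrict-bounded p , λ x e → restrict-dominated (inj₂ c) (d (old x) e)
  restrict-PR p@(b , d) (inj₂ c) = restrict-bounded p , λ x e → restrict-dominated (inj₁ λ { refl → c e }) (d (old x) e)

  raise-PR : ∀ {g} → PR T g → g (old u) ≡ 0 → PR G (upd u 1 (g ∘ old))
  raise-PR p@(b , d) e = upd-PR {G = G} u (restrict-bounded p) (λ x x≢u ex → restrict-dominated (inj₁ x≢u) (d (old x) ex)) e

  extend-PR : ∀ {f a b c} → PR G f → a ≤ 2 → b ≤ 2 → c ≤ 2 → a ≢ 2 ⊎ f u ≢ 0 →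
    (∀ x → x ≡ zero ⊎ x ≡ suc zero ⊎ x ≡ suc (suc zero) → (a ▸ b ▸ c ▸ f) x ≡ 0 → Dominated T (a ▸ b ▸ c ▸ f) x) →
    PR T (a ▸ b ▸ c ▸ f)
  extend-PR {f} {a} {b} {c} (bf , df) a≤2 b≤2 c≤2 cnd new = bnd , dom
    where
    bnd : Bounded (a ▸ b ▸ c ▸ f)
    bnd zero = a≤2
    bnd (suc zero) = b≤2
    bnd (suc (suc zero)) = c≤2
    bnd (suc (suc (suc x))) = bf x
    cond : ∀ x → f x ≡ 0 → x ≢ u ⊎ a ≢ 2
    cond x e = [ inj₂ , (λ c′ → inj₁ λ { refl → c′ e }) ]′ cnd
    dom : ∀ x → (a ▸ b ▸ c ▸ f) x ≡ 0 → Dominated T (a ▸ b ▸ c ▸ f) x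
    dom zero = new _ (inj₁ refl)
    dom (suc zero) = new _ (inj₂ (inj₁ refl))
    dom (suc (suc zero)) = new _ (inj₂ (inj₂ refl))
    dom (suc (suc (suc x))) e = extend-dominated (cond x e) (df x e)

  centre-dominates₀ : ∀ {f a c} → f u ≢ 2 → Dominated T (a ▸ 2 ▸ c ▸ f) zero
  centre-dominates₀ {f} u≢2 = suc zero , (refl , refl) ,
    λ { (suc zero) _ _ → refl ; (suc (suc (suc i))) a e → ⊥-elim (u≢2 (subst (λ j → f j ≡ 2) (≡-adj a) e)) }

  centre-dominates₂ : ∀ {f a c} → Dominated T (a ▸ 2 ▸ c ▸ f) (suc (suc zero))
  centre-dominates₂ = suc zero , (refl , refl) , λ { (suc zero) _ _ → refl }

  extend-centre : ∀ {f} a c → a ≤ 1 → c ≤ 1 → PR G f → f u ≢ 2 → PR T (a ▸ 2 ▸ c ▸ f)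
  extend-centre a c a≤1 c≤1 p u≢2 = extend-PR p (m≤n⇒m≤1+n a≤1) ≤-refl (m≤n⇒m≤1+n c≤1) (inj₁ λ { refl → case a≤1 of λ { (s≤s ()) } })
    λ { _ (inj₁ refl) _ → centre-dominates₀ u≢2 ; _ (inj₂ (inj₁ refl)) () ; _ (inj₂ (inj₂ refl)) _ → centre-dominates₂ }

  extend-ones : ∀ {f} → PR G f → PR T (1 ▸ 1 ▸ 1 ▸ f)
  extend-ones p = extend-PR p (s≤s z≤n) (s≤s z≤n) (s≤s z≤n) (inj₁ λ ())
    λ { _ (inj₁ refl) () ; _ (inj₂ (inj₁ refl)) () ; _ (inj₂ (inj₂ refl)) () }

  -- Either g restricts to G, or v₃ dominates u and u has to be raised to 1.
  cases : (g : Fin (3 + n) → ℕ) → (g zero ≢ 2 ⊎ g (old u) ≢ 0) ⊎ (g zero ≡ 2 × g (old u) ≡ 0)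
  cases g with g zero ℕ.≟ 2 | g (old u) ℕ.≟ 0
  ... | no p  | _     = inj₁ (inj₁ p)
  ... | yes _ | no q  = inj₁ (inj₂ q)
  ... | yes p | yes q = inj₂ (p , q)

-- Rigidity of the generated trees

-- In the generated trees the minimum is attained only once; this makes the induction work.
record Rigid {n} (G : Graph n) : Set where
  field
    f    : Fin n → ℕ
    pr   : PR G f
    f≢1  : ∀ x → f x ≢ 1
    min  : ∀ g → PR G g → Σᶠ f ≤ Σᶠ g
    uniq : ∀ g → PR G g → Σᶠ g ≡ Σᶠ f → ∀ x → g x ≡ f x
    ex   : ∀ x → ∃ λ h → PR G h × h x ≡ 1 × Σᶠ h ≡ suc (Σᶠ f) × (∀ w → f w ≡ 0 → h w ≢ 2)

Rigid⇒Stab : Rigid G → Stab G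
Rigid⇒Stab {G = G} R = record
  { f = f ; pr = pr ; min = min
  ; one = λ g x gp gx → ≤∧≢⇒< (min g gp) λ e → f≢1 x (trans (sym (uniq g gp (sym e) x)) gx)
  ; ex = λ x → let (h , hp , hx , hw , _) = ex x in h , hp , hx , hw }
  where open Rigid R

P3-Rigid : Rigid P3
P3-Rigid = record
  { f = 0 ▸ 2 ▸ 0 ▸ λ ()
  ; pr = ends-dominated 0 0 z≤n z≤n
  ; f≢1 = λ { zero () ; (suc zero) () ; (suc (suc zero)) () }
  ; min = min ; uniq = uniq
  ; ex = λ { zero → _ , ends-dominated 1 0 ≤-refl z≤n , refl , refl , λ { zero _ () ; (suc (suc zero)) _ () }
           ; (suc zero) → 1 ▸ 1 ▸ 1 ▸ (λ ()) , ((λ { zero → s≤s z≤n ; (suc zero) → s≤s z≤n ; (suc (suc zero)) → s≤s z≤n }) ,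
               λ { zero () ; (suc zero) () ; (suc (suc zero)) () }) , refl , refl , λ { zero _ () ; (suc (suc zero)) _ () }
           ; (suc (suc zero)) → _ , ends-dominated 0 1 z≤n ≤-refl , refl , refl , λ { zero _ () ; (suc (suc zero)) _ () } } }
  where
  ends-dominated : ∀ a c → a ≤ 1 → c ≤ 1 → PR P3 (a ▸ 2 ▸ c ▸ λ ())
  ends-dominated a c a≤1 c≤1 =
    (λ { zero → m≤n⇒m≤1+n a≤1 ; (suc zero) → ≤-refl ; (suc (suc zero)) → m≤n⇒m≤1+n c≤1 }) ,
    λ { zero _ → suc zero , (refl , refl) , λ { (suc zero) _ _ → refl ; zero () ; (suc (suc zero)) () }
      ; (suc (suc zero)) _ → suc zero , (refl , refl) , λ { (suc zero) _ _ → refl ; zero () ; (suc (suc zero)) () } }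
  end₀ : ∀ {g} → PR P3 g → g zero ≡ 0 → g (suc zero) ≡ 2
  end₀ (b , d) e with d _ e
  ... | suc zero , (_ , v2) , _ = v2
  end₂ : ∀ {g} → PR P3 g → g (suc (suc zero)) ≡ 0 → g (suc zero) ≡ 2
  end₂ (b , d) e with d _ e
  ... | suc zero , (_ , v2) , _ = v2
  centre : ∀ {g} → PR P3 g → g (suc zero) ≡ 0 → g zero ≡ 2 ⊎ g (suc (suc zero)) ≡ 2
  centre (b , d) e with d _ e
  ... | zero , (_ , v2) , _ = inj₁ v2
  ... | suc (suc zero) , (_ , v2) , _ = inj₂ v2
  min : ∀ g → PR P3 g → 2 ≤ Σᶠ g
  min g p with g zero in e₀ | g (suc (suc zero)) in e₂
  ... | 0     | _     rewrite end₀ p e₀ = s≤s (s≤s z≤n)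
  ... | suc _ | 0     rewrite end₂ p e₂ = m≤n+m 2 (suc _)
  ... | suc a | suc c = s≤s (≤-trans (≤-trans (s≤s z≤n) (m≤n+m _ (g (suc zero)))) (m≤n+m _ a))
  vals : ∀ g → PR P3 g → Σᶠ g ≡ 2 → g zero ≡ 0 × g (suc zero) ≡ 2 × g (suc (suc zero)) ≡ 0
  vals g p w with g zero in e₀ | g (suc zero) in e₁ | g (suc (suc zero)) in e₂ | w
  ... | 0 | a | c | w′ rewrite trans (sym e₁) (end₀ p e₀) = refl , refl , trans (sym (+-identityʳ c)) (+-cancelˡ-≡ 2 _ _ w′)
  ... | suc z | a | 0 | w′ rewrite trans (sym e₁) (end₂ p e₂) = case subst (_≡ 2) (+-comm (suc z) 2) w′ of λ ()
  ... | suc z | suc a | suc c | w′ = case trans (sym (solve 3 (λ z a c → con 1 :+ z :+ (con 1 :+ a :+ (con 1 :+ c :+ con 0)) := con 3 :+ (z :+ a :+ c)) refl z a c)) w′ of λ ()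
  ... | suc z | 0 | suc c | w′ with centre p e₁
  ...   | inj₁ q rewrite ℕₚ.suc-injective (trans (sym e₀) q) = case w′ of λ ()
  ...   | inj₂ q rewrite ℕₚ.suc-injective (trans (sym e₂) q) = case subst (_≡ 2) (+-comm (suc z) 2) w′ of λ ()
  uniq : ∀ g → PR P3 g → Σᶠ g ≡ 2 → ∀ x → g x ≡ (0 ▸ 2 ▸ 0 ▸ λ ()) x
  uniq g p w = let (v₀ , v₁ , v₂) = vals g p w in λ { zero → v₀ ; (suc zero) → v₁ ; (suc (suc zero)) → v₂ }

-- Unless v₃ dominates `u`, a PRDF of the new tree restricts to one of the old tree, and the path
-- adds at least 2. As `InW` gives `f u = 0`, the values 0, 2, 0 on the path extend the old minimum.
Gen⇒Rigid : Gen n G → Rigid G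
Gen⇒Rigid base = P3-Rigid
Gen⇒Rigid (op {G = G} gen u inW) = record
  { f = 0 ▸ 2 ▸ 0 ▸ f
  ; pr = extend-centre 0 0 z≤n z≤n pr u≢2
  ; f≢1 = λ { (suc (suc (suc x))) e → f≢1 x e }
  ; min = min′
  ; uniq = uniq′
  ; ex = ex′ }
  where
  open O₁ G u
  R = Gen⇒Rigid gen
  open Rigid R
  fu : f u ≡ 0
  fu = inW f (PR⇒IsPRDF pr , λ g gp → min g (IsPRDF⇒PR gp))
  u≢2 : f u ≢ 2
  u≢2 e = case trans (sym fu) e of λ ()
  -- Raising `u` to 1 costs 1, which the strict bound for functions with a value 1 gives back; the
  -- third unit on the path then makes the inequality strict.
  raised : ∀ g → PR T g → g zero ≡ 2 → g (old u) ≡ 0 → 2 + Σᶠ f < Σᶠ g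
  raised g gp z2 gu = ≤-trans (+-mono-≤ (path-≥3 g gp z2)
      (ℕ.s≤s⁻¹ (≤-trans (Stab.one (Rigid⇒Stab R) _ u (raise-PR gp gu) (upd-same u {1} {g ∘ old})) (≤-reflexive (Σᶠ-raise {f = g ∘ old} u gu)))))
    (≤-reflexive (sym (Σᶠ-split g)))
  min′ : ∀ g → PR T g → 2 + Σᶠ f ≤ Σᶠ g
  min′ g gp with cases g
  ... | inj₁ c = ≤-trans (+-mono-≤ (path-≥2 g gp) (min _ (restrict-PR gp c))) (≤-reflexive (sym (Σᶠ-split g)))
  ... | inj₂ (z2 , gu) = <⇒≤ (raised g gp z2 gu)
  uniq′ : ∀ g → PR T g → Σᶠ g ≡ 2 + Σᶠ f → ∀ x → g x ≡ (0 ▸ 2 ▸ 0 ▸ f) x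
  uniq′ g gp e with cases g
  ... | inj₂ (z2 , gu) = ⊥-elim (<-irrefl (sym e) (raised g gp z2 gu))
  ... | inj₁ c = λ { zero → proj₁ new ; (suc zero) → proj₁ (proj₂ new) ; (suc (suc zero)) → proj₂ (proj₂ new) ; (suc (suc (suc x))) → same x }
    where
    rp = restrict-PR gp c
    e′ : path g + Σᶠ (g ∘ old) ≡ 2 + Σᶠ f
    e′ = trans (sym (Σᶠ-split g)) e
    w≤ : Σᶠ (g ∘ old) ≤ Σᶠ f
    w≤ = +-cancelˡ-≤ 2 _ _ (≤-trans (+-monoˡ-≤ _ (path-≥2 g gp)) (≤-reflexive e′))
    same : ∀ x → g (old x) ≡ f x
    same = uniq _ rp (≤-antisym w≤ (min _ rp))
    gu = trans (same u) fu
    new = path-≡2 g gp (λ q → case trans (sym gu) q of λ ()) ([ id , (λ q → ⊥-elim (q gu)) ]′ c)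
      (+-cancelʳ-≡ (Σᶠ f) _ _ (trans (cong (path g +_) (Σᶠ-cong (sym ∘ same))) e′))
  zero≢2 : ∀ {h : Fin _ → ℕ} → (∀ w → f w ≡ 0 → h w ≢ 2) → ∀ {a c} → a ≢ 2 → c ≢ 2 → ∀ {b} w → (0 ▸ 2 ▸ 0 ▸ f) w ≡ 0 → (a ▸ b ▸ c ▸ h) w ≢ 2
  zero≢2 q a c zero _ = a
  zero≢2 q a c (suc (suc zero)) _ = c
  zero≢2 q a c (suc (suc (suc w))) e = q w e
  f≢2 : ∀ w → f w ≡ 0 → f w ≢ 2
  f≢2 w e e′ = case trans (sym e) e′ of λ ()
  ex′ : ∀ x → ∃ λ h → PR T h × h x ≡ 1 × Σᶠ h ≡ suc (2 + Σᶠ f) × (∀ w → (0 ▸ 2 ▸ 0 ▸ f) w ≡ 0 → h w ≢ 2)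
  ex′ zero = 1 ▸ 2 ▸ 0 ▸ f , extend-centre 1 0 ≤-refl z≤n pr u≢2 , refl , refl , zero≢2 f≢2 (λ ()) (λ ())
  ex′ (suc zero) = 1 ▸ 1 ▸ 1 ▸ f , extend-ones pr , refl , refl , zero≢2 f≢2 (λ ()) (λ ())
  ex′ (suc (suc zero)) = 0 ▸ 2 ▸ 1 ▸ f , extend-centre 0 1 z≤n ≤-refl pr u≢2 , refl , refl , zero≢2 f≢2 (λ ()) (λ ())
  -- As `u` is a zero of `f`, the last clause of `ex` gives `h u ≢ 2`, and v₃ is dominated by v₂
  -- alone. This is the purpose of that clause in `Rigid`.
  ex′ (suc (suc (suc x))) = let (h , hp , hx , hw , hz) = ex x in
    0 ▸ 2 ▸ 0 ▸ h , extend-centre 0 0 z≤n z≤n hp (hz u fu) , hx , cong (2 +_) hw , zero≢2 hz (λ ()) (λ ())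

-- Branches of a tree at a vertex

data Avoid {n} (G : Graph n) (y : Fin n) : Fin n → Fin n → Set where
  stop : ∀ {u} → u ≢ y → Avoid G y u u
  move : ∀ {u v w} → u ≢ y → Adj G u v → Avoid G y v w → Avoid G y u w

-- The vertices are listed because `HasCycle` asks for a list; `v` is the last of them and `y` does
-- not occur.
data SimplePath {n} (G : Graph n) (y v : Fin n) : List (Fin n) → Set where
  single  : v ≢ y → SimplePath G y v (v ∷ [])
  more : ∀ {u w l} → u ≢ y → u ∉ w ∷ l → Adj G u w → SimplePath G y v (w ∷ l) → SimplePath G y v (u ∷ w ∷ l)

suffix : ∀ {y v u l} → u ∈ l → SimplePath G y v l → ∃ λ l′ → SimplePath G y v (u ∷ l′)
suffix (here refl) p@(single _)            = [] , p
suffix (here refl) p@(more _ _ _ _)     = _ , p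
suffix (there i)   (more _ _ _ p)       = suffix i p

-- Shortcutting: if the new first vertex already lies on the path, the path is cut back to the part
-- that starts there.
simplePath : ∀ {y u v} → Avoid G y u v → ∃ λ l → SimplePath G y v (u ∷ l)
simplePath (stop ne) = [] , single ne
simplePath {u = u} (move ne a p) with simplePath p
... | l , q with DecMembership._∈?_ _≟_ u (_ ∷ l)
...   | yes i = suffix i q
...   | no ∉l = _ , more ne ∉l a q

simple-unique : ∀ {y v l} → SimplePath G y v l → Unique l
simple-unique (single _) = [] ∷ []
simple-unique (more _ ∉l _ p) = ¬Any⇒All¬ _ ∉l ∷ simple-unique p

simple-avoids : ∀ {y v l} → SimplePath G y v l → All (y ≢_) l
simple-avoids (single ne) = (ne ∘ sym) ∷ []
simple-avoids (more ne _ _ p) = (ne ∘ sym) ∷ simple-avoids p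

simple-linked : ∀ {y v l} → Adj G v y → SimplePath G y v l → Linked (Adj G) (l ∷ʳ y)
simple-linked a (single _) = a ∷ [-]
simple-linked a (more _ _ e p) = e ∷ simple-linked a p

module Branches {n} (G : Graph n) (tree : IsTree G) where

  symm : ∀ {u v} → Adj G u v → Adj G v u
  symm {u} {v} a = trans (proj₁ (proj₁ tree) v u) a

  irrefl : ∀ {u v} → Adj G u v → u ≢ v
  irrefl a refl = case trans (sym a) (proj₂ (proj₁ tree) _) of λ ()

  avoid-trans : ∀ {y u v w} → Avoid G y u v → Avoid G y v w → Avoid G y u w
  avoid-trans (stop _) q = q
  avoid-trans (move ne a p) q = move ne a (avoid-trans p q)

  avoid-start : ∀ {y u v} → Avoid G y u v → u ≢ y
  avoid-start (stop ne) = ne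
  avoid-start (move ne _ _) = ne

  avoid-sym : ∀ {y u v} → Avoid G y u v → Avoid G y v u
  avoid-sym (stop ne) = stop ne
  avoid-sym (move ne a p) = avoid-trans (avoid-sym p) (move (avoid-start p) (symm a) (stop ne))

  -- The walk is followed up to its first visit to `y`; `x` is the vertex just before.
  gate : ∀ {y u} → Reach G u y → u ≢ y → ∃ λ x → Adj G y x × Avoid G y u x
  gate here ne = ⊥-elim (ne refl)
  gate {y} (step {v = v} a r) ne with v ≟ y
  ... | yes refl = _ , symm a , stop ne
  ... | no v≢y = let (x , ax , p) = gate r v≢y in x , ax , move ne a p

  -- Two different neighbours of `y` joined by a walk avoiding `y` would close up to a cycle through
  -- `y`.
  gate-unique : ∀ {y x x′} → Adj G y x → Adj G y x′ → Avoid G y x x′ → x ≡ x′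
  gate-unique {y} {x} {x′} a a′ p with simplePath p
  ... | [] , single _ = refl
  ... | w ∷ l , q = ⊥-elim (proj₂ (proj₂ tree) (y , x ∷ w ∷ l , s≤s (s≤s z≤n) ,
          simple-avoids q ∷ simple-unique q , a ∷ simple-linked (symm a′) q))

  -- For u ≢ y, br y u is the neighbour of y on the path from y to u.
  abstract
    br : Fin n → Fin n → Fin n
    br y u with u ≟ y
    ... | yes _ = y
    ... | no ne = proj₁ (gate (proj₁ (proj₂ tree) u y) ne)

    br-self : ∀ y → br y y ≡ y
    br-self y with y ≟ y
    ... | yes _ = refl
    ... | no ne = ⊥-elim (ne refl)

    br-gate : ∀ {y u} → u ≢ y → Adj G y (br y u) × Avoid G y u (br y u)
    br-gate {y} {u} ne with u ≟ y
    ... | yes e = ⊥-elim (ne e)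
    ... | no ne′ = proj₂ (gate (proj₁ (proj₂ tree) u y) ne′)

  br-unique : ∀ {y u x} → Adj G y x → Avoid G y u x → br y u ≡ x
  br-unique a p = let (b , q) = br-gate (avoid-start p) in gate-unique b a (avoid-trans (avoid-sym q) p)

  br-nbr : ∀ {y x} → Adj G y x → br y x ≡ x
  br-nbr a = br-unique a (stop (irrefl (symm a)))

  br-edge : ∀ {y u v} → u ≢ y → v ≢ y → Adj G u v → br y u ≡ br y v
  br-edge nu nv a = let (b , q) = br-gate nv in br-unique b (move nu a q)

  br-≢ : ∀ {y u x} → Adj G y x → br y u ≡ x → u ≢ y
  br-≢ a e refl = irrefl a (trans (sym (br-self _)) e)

  -- A walk from `u` to `c` avoiding `b` cannot meet `a`, because the branch of `a` at `b` is `a`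
  -- itself and `c ≢ a`. So this walk, followed by the edge to `b`, reaches `b` without meeting `a`.
  br-sub : ∀ {a b c u} → Adj G a b → Adj G b c → c ≢ a → br b u ≡ c → u ≢ a × br a u ≡ b
  br-sub {a} {b} {c} ab bc c≢a e = along (subst (Avoid G b _) e (proj₂ (br-gate (br-≢ bc e))))
    where
    along : ∀ {u} → Avoid G b u c → u ≢ a × br a u ≡ b
    along (stop _) = c≢a , trans (br-edge c≢a (irrefl (symm ab)) (symm bc)) (br-nbr ab)
    along p@(move _ uv q) = u≢a , trans (br-edge u≢a (proj₁ (along q)) uv) (proj₂ (along q))
      where
      u≢a : _ ≢ a
      u≢a refl = c≢a (trans (sym (br-unique bc p)) (br-nbr (symm ab)))

  in-branch : Fin n → Fin n → Fin n → Bool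
  in-branch y x u = does (x ≟ br y u)

  in-branch⇒ : ∀ {y x u} → in-branch y x u ≡ true → br y u ≡ x
  in-branch⇒ {y} {x} {u} e with x ≟ br y u
  ... | yes p = sym p

  in-branch⇐ : ∀ {y x u} → br y u ≡ x → in-branch y x u ≡ true
  in-branch⇐ {y} {x} {u} e with x ≟ br y u
  ... | yes p = refl
  ... | no np = ⊥-elim (np (sym e))

  size : Fin n → Fin n → ℕ
  size y x = count (in-branch y x)

  -- The larger branch also contains `b`. This is the measure for all descents along the tree.
  size-< : ∀ {a b c} → Adj G a b → Adj G b c → c ≢ a → size b c < size a b
  size-< {a} {b} {c} ab bc c≢a = subst (_≤ size a b)
      (trans (Σᶠ-+ (λ u → if in-branch b c u then 1 else 0) (at b 1)) (trans (cong (size b c +_) (Σᶠ-at b 1)) (+-comm _ 1))) (Σᶠ-mono pointwise)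
    where
    pointwise : ∀ u → (if in-branch b c u then 1 else 0) + at b 1 u ≤ (if in-branch a b u then 1 else 0)
    pointwise u with u ≟ b
    ... | yes refl rewrite in-branch⇐ {a} (br-nbr ab) with in-branch b c b in e
    ...   | true  = ⊥-elim (br-≢ bc (in-branch⇒ e) refl)
    ...   | false = ≤-refl
    pointwise u | no _ with in-branch b c u in e
    ...   | false = z≤n
    ...   | true rewrite in-branch⇐ {a} (proj₂ (br-sub ab bc c≢a (in-branch⇒ e))) = ≤-refl

-- Exchanging a function on one branch

dominated-cong : ∀ (G : Graph n) {f h : Fin n → ℕ} {u} → (∀ w → Adj G u w → h w ≡ f w) → Dominated G f u → Dominated G h u
dominated-cong G eq (v , (a , v2) , uniq) = v , (a , trans (eq v a) v2) , λ w aw w2 → uniq w aw (trans (sym (eq w aw)) w2)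

module Hybrid {n} (G : Graph n) (tree : IsTree G) (y x : Fin n) where

  open Branches G tree

  branch : (Fin n → ℕ) → ℕ
  branch f = Σᶠ (λ u → if in-branch y x u then f u else 0)

  hybrid : (g f : Fin n → ℕ) → Fin n → ℕ
  hybrid g f u = if in-branch y x u then g u else f u

  hybrid-in : ∀ g f {u} → br y u ≡ x → hybrid g f u ≡ g u
  hybrid-in g f {u} e rewrite in-branch⇐ {y} {x} {u} e = refl

  hybrid-out : ∀ g f {u} → br y u ≢ x → hybrid g f u ≡ f u
  hybrid-out g f {u} ne with in-branch y x u in e
  ... | true  = ⊥-elim (ne (in-branch⇒ e))
  ... | false = refl

  Σᶠ-hybrid : ∀ g f → Σᶠ (hybrid g f) + branch f ≡ Σᶠ f + branch g
  Σᶠ-hybrid g f = trans (sym (Σᶠ-+ (hybrid g f) (λ u → if in-branch y x u then f u else 0)))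
    (trans (Σᶠ-cong pointwise) (Σᶠ-+ f (λ u → if in-branch y x u then g u else 0)))
    where
    pointwise : ∀ u → hybrid g f u + (if in-branch y x u then f u else 0) ≡ f u + (if in-branch y x u then g u else 0)
    pointwise u with in-branch y x u
    ... | true  = +-comm (g u) (f u)
    ... | false = refl

  -- Since `f` and the hybrid agree off the branch, a comparison of total weights becomes one on the
  -- branch alone; `c` and `d` are a gain and a permitted defect.
  branch-compare : ∀ g f c d → Σᶠ f + c ≤ Σᶠ (hybrid g f) + d → branch f + c ≤ branch g + d
  branch-compare g f c d l = +-cancelˡ-≤ (Σᶠ f) _ _ (begin
    Σᶠ f + (branch f + c)              ≡⟨ solve 3 (λ a b c → a :+ (b :+ c) := a :+ c :+ b) refl (Σᶠ f) (branch f) c ⟩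
    Σᶠ f + c + branch f                ≤⟨ +-monoˡ-≤ (branch f) l ⟩
    Σᶠ (hybrid g f) + d + branch f     ≡⟨ solve 3 (λ a b c → a :+ c :+ b := a :+ b :+ c) refl (Σᶠ (hybrid g f)) (branch f) d ⟩
    Σᶠ (hybrid g f) + branch f + d     ≡⟨ cong (_+ d) (Σᶠ-hybrid g f) ⟩
    Σᶠ f + branch g + d                ≡⟨ +-assoc (Σᶠ f) (branch g) d ⟩
    Σᶠ f + (branch g + d)              ∎)
    where open ≤-Reasoning

  module _ (yx : Adj G y x) where

    dominated-in : ∀ {g f u} → br y u ≡ x → u ≢ x → Dominated G g u → Dominated G (hybrid g f) u
    dominated-in {g} {f} {u} e u≢x = dominated-cong G λ w uw → hybrid-in g f (trans (sym (br-edge (br-≢ yx e) (w≢y uw) uw)) e)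
      where
      w≢y : ∀ {w} → Adj G u w → w ≢ y
      w≢y uw refl = u≢x (trans (sym (br-nbr (symm uw))) e)

    dominated-out : ∀ {g f u} → br y u ≢ x → u ≢ y → Dominated G f u → Dominated G (hybrid g f) u
    dominated-out {g} {f} {u} ne u≢y = dominated-cong G λ w uw → hybrid-out g f λ e →
      ne (trans (br-edge u≢y (br-≢ yx e) uw) e)

    -- Off x and y, no neighbourhood sees both f and g.
    hybrid-dominated : ∀ {g f} → (∀ u → g u ≡ 0 → br y u ≡ x → u ≢ x → Dominated G g u) → (∀ u → f u ≡ 0 → Dominated G f u) →
      ∀ u → hybrid g f u ≡ 0 → u ≢ x → u ≢ y → Dominated G (hybrid g f) u
    hybrid-dominated {g} {f} dg df u e u≢x u≢y with br y u ≟ x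
    ... | yes p = dominated-in p u≢x (dg u (trans (sym (hybrid-in g f p)) e) p u≢x)
    ... | no ¬p = dominated-out ¬p u≢y (df u (trans (sym (hybrid-out g f ¬p)) e))

    hybrid-root : ∀ g f → hybrid g f y ≡ f y
    hybrid-root g f = hybrid-out g f λ e → br-≢ yx e refl

    hybrid-nbr : ∀ g f → hybrid g f x ≡ g x
    hybrid-nbr g f = hybrid-in g f (br-nbr yx)

  hybrid-bounded : ∀ g f → Bounded g → Bounded f → Bounded (hybrid g f)
  hybrid-bounded g f bg bf u with in-branch y x u
  ... | true  = bg u
  ... | false = bf u

-- Weight comparisons in a stable tree

module Stable {n} (G : Graph n) (tree : IsTree G) (S : Stab G) where

  open Branches G tree
  open Stab S

  branch : Fin n → Fin n → (Fin n → ℕ) → ℕ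
  branch y x = Hybrid.branch G tree y x

  -- Each `u` is counted once, at `br y u`. The sum runs over all `x`: those not adjacent to `y`
  -- contribute 0, except that `x = y` contributes `g y`, because `br y y` is `y`.
  Σᶠ-branch : ∀ y g → Σᶠ (λ x → branch y x g) ≡ Σᶠ g
  Σᶠ-branch y g = trans (Σᶠ-comm (λ x u → at (br y u) (g u) x)) (Σᶠ-cong λ u → Σᶠ-at (br y u) (g u))

  branch-none : ∀ {y x} g → x ≢ y → ¬ Adj G y x → branch y x g ≡ 0
  branch-none {y} {x} g x≢y na = Σᶠ-zero pointwise
    where
    pointwise : ∀ u → (if in-branch y x u then g u else 0) ≡ 0
    pointwise u with in-branch y x u in e
    ... | false = refl
    ... | true with u ≟ y
    ...   | yes refl = ⊥-elim (x≢y (trans (sym (in-branch⇒ e)) (br-self y)))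
    ...   | no u≢y = ⊥-elim (na (subst (Adj G y) (in-branch⇒ e) (proj₁ (br-gate u≢y))))

  branch-self : ∀ y g → branch y y g ≡ g y
  branch-self y g = trans (Σᶠ-cong pointwise) (Σᶠ-at y (g y))
    where
    pointwise : ∀ u → (if in-branch y y u then g u else 0) ≡ at y (g y) u
    pointwise u with u ≟ y
    ... | yes refl rewrite in-branch⇐ (br-self y) = refl
    ... | no u≢y with in-branch y y u in e
    ...   | false = refl
    ...   | true = ⊥-elim (irrefl (proj₁ (br-gate u≢y)) (sym (in-branch⇒ e)))

  f≢1 : ∀ x → f x ≢ 1
  f≢1 x e = <-irrefl refl (one f x pr e)

  f-values : ∀ x → f x ≡ 0 ⊎ f x ≡ 2
  f-values x with f x in e | proj₁ pr x
  ... | 0 | _ = inj₁ refl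
  ... | 1 | _ = ⊥-elim (f≢1 x e)
  ... | 2 | _ = inj₂ refl
  ... | suc (suc (suc _)) | s≤s (s≤s ())

  f-not-both : ∀ {x} → f x ≡ 0 → f x ≢ 2
  f-not-both e e′ = case trans (sym e) e′ of λ ()

  -- Raising an undominated zero to 1 adds 1 to the weight, and so does the minimum over functions with a value 1.
  one-exception : ∀ g p → Bounded g → (∀ u → g u ≡ 0 → u ≢ p → Dominated G g u) → Σᶠ f ≤ Σᶠ g
  one-exception g p b d with g p ℕ.≟ 0
  ... | yes gp = ℕ.s≤s⁻¹ (≤-trans (one _ p (upd-PR {G = G} p b (λ x ne e → d x e ne) gp) (upd-same p {1} {g})) (≤-reflexive (Σᶠ-raise {f = g} p gp)))
  ... | no g≢0 = min g (b , λ u e → d u e λ { refl → g≢0 e })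

  -- One of the two raises is free as before, and the other one costs 1.
  two-exceptions : ∀ g p q → Bounded g → (∀ u → g u ≡ 0 → u ≢ p → u ≢ q → Dominated G g u) → Σᶠ f ≤ suc (Σᶠ g)
  two-exceptions g p q b d with g p ℕ.≟ 0
  ... | no g≢0 = m≤n⇒m≤1+n (one-exception g q b λ u e → d u e λ { refl → g≢0 e })
  ... | yes gp = ≤-trans (one-exception (upd p 1 g) q bnd dom) (≤-reflexive (Σᶠ-raise {f = g} p gp))
    where
    bnd : Bounded (upd p 1 g)
    bnd u with u ≟ p
    ... | yes _ = s≤s z≤n
    ... | no  _ = b u
    dom : ∀ u → upd p 1 g u ≡ 0 → u ≢ q → Dominated G (upd p 1 g) u
    dom u e u≢q with u ≟ p
    ... | yes _  = case e of λ ()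
    ... | no u≢p = upd-dominated {G = G} gp (d u e u≢p u≢q)

  -- On each branch at y, g may weigh less than f by at most 1, and this only on the branch of the
  -- unique neighbour of y with f-value 2; but g y = 2 exceeds f y by 2.
  two-at-zero : ∀ y g → f y ≡ 0 → Bounded g → g y ≡ 2 → (∀ u → g u ≡ 0 → ¬ Adj G y u → Dominated G g u) → Σᶠ f < Σᶠ g
  two-at-zero y g fy bg gy dg = +-cancelʳ-≤ 1 _ _ (begin
      suc (Σᶠ f) + 1                                                 ≡⟨ +-suc (Σᶠ f) 1 ⟨
      Σᶠ f + 2                                                       ≡⟨ cong₂ _+_ (Σᶠ-branch y f) (Σᶠ-at y 2) ⟨
      Σᶠ (λ x → branch y x f) + Σᶠ (at y 2)                          ≡⟨ Σᶠ-+ (λ x → branch y x f) (at y 2) ⟨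
      Σᶠ (λ x → branch y x f + at y 2 x)                             ≤⟨ Σᶠ-mono pointwise ⟩
      Σᶠ (λ x → branch y x g + (if G y x ∧ (f x ≡ᵇ 2) then 1 else 0)) ≡⟨ Σᶠ-+ (λ x → branch y x g) _ ⟩
      Σᶠ (λ x → branch y x g) + count (λ x → G y x ∧ (f x ≡ᵇ 2))     ≡⟨ cong₂ _+_ (Σᶠ-branch y g) (Dominated⇒count G y (proj₂ pr y fy)) ⟩
      Σᶠ g + 1                                                       ∎)
    where
    open ≤-Reasoning
    adjacent : ∀ x → Adj G y x → branch y x f + 0 ≤ branch y x g + (if (f x ≡ᵇ 2) then 1 else 0)
    adjacent x yx = by (f x ℕ.≟ 2) (g x ℕ.≟ 2)
      where
      open Hybrid G tree y x hiding (branch)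
      h = hybrid g f
      bh : Bounded h
      bh = hybrid-bounded g f bg (proj₁ pr)
      dh : ∀ u → h u ≡ 0 → u ≢ x → u ≢ y → Dominated G h u
      dh = hybrid-dominated yx (λ u e p u≢x → dg u e λ a → u≢x (trans (sym (br-nbr a)) p)) (proj₂ pr)
      dy : f x ≢ 2 → g x ≢ 2 → Dominated G h y
      dy fx gx = dominated-cong′ (proj₂ pr y fy)
        where
        other : ∀ {w} → Adj G y w → w ≢ x → h w ≡ f w
        other yw w≢x = hybrid-out g f λ e → w≢x (trans (sym (br-nbr yw)) e)
        dominated-cong′ : Dominated G f y → Dominated G h y
        dominated-cong′ (v , (a , v2) , uniq) = v , (a , trans (other a λ { refl → fx v2 }) v2) ,
          λ w aw w2 → uniq w aw (trans (sym (other aw λ { refl → gx (trans (sym (hybrid-nbr yx g f)) w2) })) w2)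
      at-least : Σᶠ f ≤ Σᶠ h → branch y x f + 0 ≤ branch y x g + (if (f x ≡ᵇ 2) then 1 else 0)
      at-least l = ≤-trans (branch-compare g f 0 0 (+-monoˡ-≤ 0 l)) (+-monoʳ-≤ (branch y x g) z≤n)
      by : Dec (f x ≡ 2) → Dec (g x ≡ 2) → branch y x f + 0 ≤ branch y x g + (if (f x ≡ᵇ 2) then 1 else 0)
      -- If `f x = 2`, then `x` is the dominator of `y`, and both ends of the edge may be spoilt, at
      -- the cost of 1. If only `g x = 2`, then `x` is not a zero; if neither holds, the 2s around
      -- `y` are unchanged. A single exception remains in these two cases.
      by (yes fx) _ rewrite fx = branch-compare g f 0 1 (subst₂ _≤_ (sym (+-identityʳ _)) (+-comm 1 _) (two-exceptions h x y bh dh))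
      by (no fx) (yes gx) = at-least (one-exception h y bh λ u e u≢y → dh u e (λ { refl → case trans (sym e) (trans (hybrid-nbr yx g f) gx) of λ () }) u≢y)
      by (no fx) (no gx)  = at-least (one-exception h x bh λ u e u≢x → case u ≟ y of λ { (yes refl) → dy fx gx ; (no u≢y) → dh u e u≢x u≢y })
    pointwise : ∀ x → branch y x f + at y 2 x ≤ branch y x g + (if G y x ∧ (f x ≡ᵇ 2) then 1 else 0)
    pointwise x with x ≟ y
    ... | yes refl rewrite branch-self y f | branch-self y g | fy | gy = m≤m+n 2 _
    ... | no x≢y with G y x in a
    ...   | true = adjacent x a
    ...   | false rewrite branch-none f x≢y (λ b → case trans (sym a) b of λ ()) = z≤n

  -- When `f v = 2`, these are the zeros that have `v` as their unique dominator.
  private-nbr : Fin n → Fin n → Bool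
  private-nbr v x = G v x ∧ (f x ≡ᵇ 0)

  -- Take h with h v = 1 and weight one above the minimum. On the branch at x, h weighs at least as much
  -- as f, and strictly more if f x = 0.
  private-≤2 : ∀ v → f v ≡ 2 → count (private-nbr v) ≤ 2
  private-≤2 v fv with ex v
  ... | h , hp , hv , hw = +-cancelˡ-≤ (Σᶠ f) _ _ (begin
      Σᶠ f + count (private-nbr v)                                      ≡⟨ cong (_+ count (private-nbr v)) (Σᶠ-branch v f) ⟨
      Σᶠ (λ x → branch v x f) + count (private-nbr v)                   ≡⟨ Σᶠ-+ (λ x → branch v x f) (λ x → if private-nbr v x then 1 else 0) ⟨
      Σᶠ (λ x → branch v x f + (if private-nbr v x then 1 else 0))      ≤⟨ Σᶠ-mono pointwise ⟩
      Σᶠ (λ x → branch v x h + at v 1 x)                                ≡⟨ Σᶠ-+ (λ x → branch v x h) (at v 1) ⟩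
      Σᶠ (λ x → branch v x h) + Σᶠ (at v 1)                             ≡⟨ cong₂ _+_ (Σᶠ-branch v h) (Σᶠ-at v 1) ⟩
      Σᶠ h + 1                                                          ≡⟨ cong (_+ 1) hw ⟩
      suc (Σᶠ f) + 1                                                    ≡⟨ +-suc (Σᶠ f) 1 ⟨
      Σᶠ f + 2                                                          ∎)
    where
    open ≤-Reasoning
    adjacent : ∀ x → Adj G v x → branch v x f + (if f x ≡ᵇ 0 then 1 else 0) ≤ branch v x h + 0
    adjacent x vx = by (f-values x)
      where
      open Hybrid G tree v x hiding (branch)
      mix = hybrid h f
      mix-x = hybrid-nbr vx h f
      bmix : Bounded mix
      bmix = hybrid-bounded h f (proj₁ hp) (proj₁ pr)
      dmix : ∀ u → mix u ≡ 0 → u ≢ x → Dominated G mix u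
      dmix u e u≢x = hybrid-dominated vx (λ u e _ _ → proj₂ hp u e) (proj₂ pr) u e u≢x
        λ { refl → case trans (sym e) (trans (hybrid-root vx h f) fv) of λ () }
      -- If mix has the value 2 at a vertex where f is 0, then two-at-zero applies, as x is the only
      -- zero that may fail to be dominated.
      exceeds : f x ≡ 0 → Σᶠ f < Σᶠ mix
      exceeds fx with h x in hx | proj₁ hp x
      ... | suc (suc (suc _)) | s≤s (s≤s ())
      ... | 1 | _ = one mix x (bmix , λ u e → dmix u e λ { refl → case trans (sym e) (trans mix-x hx) of λ () }) (trans mix-x hx)
      ... | 2 | _ = two-at-zero x mix fx bmix (trans mix-x hx) λ u e _ → dmix u e λ { refl → case trans (sym e) (trans mix-x hx) of λ () }
      ... | 0 | _ with proj₂ hp x hx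
      -- The dominator `z` of `x` under `h` is not `v`, since `h v = 1`, so it lies in the branch at
      -- `x`. It is a zero of `f`, since `v` is already the unique dominator of `x` under `f`.
      ...   | z , (xz , z2) , _ = two-at-zero z mix fz bmix (trans (hybrid-in h f zin) z2) λ u e na → dmix u e λ { refl → na (symm xz) }
        where
        z≢v : z ≢ v
        z≢v refl = case trans (sym hv) z2 of λ ()
        zin : br v z ≡ x
        zin = trans (sym (br-edge (irrefl (symm vx)) z≢v xz)) (br-nbr vx)
        fz : f z ≡ 0
        fz with f-values z | proj₂ pr x fx
        ... | inj₁ e | _ = e
        ... | inj₂ e | _ , _ , uniq = ⊥-elim (z≢v (trans (uniq z xz e) (sym (uniq v (symm vx) fv))))
      by : f x ≡ 0 ⊎ f x ≡ 2 → branch v x f + (if f x ≡ᵇ 0 then 1 else 0) ≤ branch v x h + 0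
      by (inj₁ fx) rewrite fx = branch-compare h f 1 0 (subst₂ _≤_ (+-comm 1 _) (sym (+-identityʳ _)) (exceeds fx))
      by (inj₂ fx) rewrite fx = branch-compare h f 0 0 (+-monoˡ-≤ 0 (one-exception mix x bmix dmix))
    pointwise : ∀ x → branch v x f + (if private-nbr v x then 1 else 0) ≤ branch v x h + at v 1 x
    pointwise x with x ≟ v
    ... | yes refl rewrite branch-self v f | branch-self v h | fv | hv | proj₂ (proj₁ tree) v = ≤-refl
    ... | no x≢v with G v x in a
    ...   | true = adjacent x a
    ...   | false rewrite branch-none f x≢v (λ b → case trans (sym a) b of λ ()) = z≤n

-- The decomposition of a stable tree into copies of P₃

module Structure {n} (G : Graph n) (tree : IsTree G) (S : Stab G) where

  open Branches G tree
  open Stable G tree S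
  open Stab S

  private-nbr⇐ : ∀ {v x} → Adj G v x → f x ≡ 0 → private-nbr v x ≡ true
  private-nbr⇐ a e = ∧-intro a (true-≡ᵇ e)

  private-nbr⇒ : ∀ {v x} → private-nbr v x ≡ true → Adj G v x × f x ≡ 0
  private-nbr⇒ {x = x} e = proj₁ (∧-true e) , ≡ᵇ-true (f x) (proj₂ (∧-true e))

  -- Change the value 2 at v to a, and the value of the zeros that v dominates to 1.
  module Release (v : Fin n) (fv : f v ≡ 2) (a : ℕ) (a≤1 : a ≤ 1) where

    g : Fin n → ℕ
    g u = if does (u ≟ v) then a else if private-nbr v u then 1 else f u

    g-at : g v ≡ a
    g-at = ≟-refl v

    g-nbr : ∀ {u} → Adj G v u → f u ≡ 0 → g u ≡ 1
    g-nbr {u} vu e with u ≟ v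
    ... | yes refl = ⊥-elim (irrefl vu refl)
    ... | no _ rewrite private-nbr⇐ vu e = refl

    g-two : ∀ {u} → u ≢ v → f u ≡ 2 → g u ≡ 2
    g-two {u} u≢v e with u ≟ v
    ... | yes p = ⊥-elim (u≢v p)
    ... | no _ with private-nbr v u in q
    ...   | true  = ⊥-elim (f-not-both (proj₂ (private-nbr⇒ q)) e)
    ...   | false = e

    g-two⁻ : ∀ u → g u ≡ 2 → u ≢ v × f u ≡ 2
    g-two⁻ u e with u ≟ v
    ... | yes refl = case ≤-trans (≤-reflexive (sym e)) a≤1 of λ { (s≤s ()) }
    ... | no u≢v with private-nbr v u
    ...   | true  = case e of λ ()
    ...   | false = u≢v , e

    bounded : Bounded g
    bounded u with u ≟ v
    ... | yes _ = m≤n⇒m≤1+n a≤1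
    ... | no  _ with private-nbr v u
    ...   | true  = s≤s z≤n
    ...   | false = proj₁ pr u

    dominated : ∀ u → u ≢ v → g u ≡ 0 → Dominated G g u
    dominated u u≢v e with u ≟ v
    ... | yes p = ⊥-elim (u≢v p)
    ... | no _ with private-nbr v u in q
    ...   | true = case e of λ ()
    ...   | false with proj₂ pr u e
    ...     | z , (uz , z2) , uniq = z , (uz , g-two (λ { refl → case trans (sym q) (private-nbr⇐ (symm uz) e) of λ () }) z2) ,
              λ w uw w2 → uniq w uw (proj₂ (g-two⁻ w w2))

    weight-g : Σᶠ g + 2 ≡ Σᶠ f + (count (private-nbr v) + a)
    weight-g = begin
      Σᶠ g + 2                                              ≡⟨ cong (Σᶠ g +_) (Σᶠ-at v 2) ⟨
      Σᶠ g + Σᶠ (at v 2)                                    ≡⟨ Σᶠ-+ g (at v 2) ⟨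
      Σᶠ (λ u → g u + at v 2 u)                             ≡⟨ Σᶠ-cong pointwise ⟩
      Σᶠ (λ u → f u + (𝟙 u + at v a u))                     ≡⟨ Σᶠ-+ f (λ u → 𝟙 u + at v a u) ⟩
      Σᶠ f + Σᶠ (λ u → 𝟙 u + at v a u)                      ≡⟨ cong (Σᶠ f +_) (Σᶠ-+ 𝟙 (at v a)) ⟩
      Σᶠ f + (count (private-nbr v) + Σᶠ (at v a))          ≡⟨ cong (λ s → Σᶠ f + (count (private-nbr v) + s)) (Σᶠ-at v a) ⟩
      Σᶠ f + (count (private-nbr v) + a)                    ∎
      where
      open ≡-Reasoning
      𝟙 : Fin n → ℕ
      𝟙 u = if private-nbr v u then 1 else 0
      pointwise : ∀ u → g u + at v 2 u ≡ f u + (𝟙 u + at v a u)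
      pointwise u with u ≟ v
      ... | yes refl rewrite fv | proj₂ (proj₁ tree) v = +-comm a 2
      ... | no _ with private-nbr v u in q
      ...   | true rewrite proj₂ (private-nbr⇒ q) = refl
      ...   | false = refl

  -- With `v` and its private neighbours set to 1, a value 1 occurs and the weight must exceed the
  -- minimum. The change of weight is the number of private neighbours minus 1.
  private-≥2 : ∀ v → f v ≡ 2 → 2 ≤ count (private-nbr v)
  private-≥2 v fv = +-cancelˡ-≤ (Σᶠ f) _ _ (ℕ.s≤s⁻¹ (begin
      suc (Σᶠ f) + 2                              ≤⟨ +-monoˡ-≤ 2 (one g v (bounded , λ u e → dominated u (λ { refl → case trans (sym e) g-at of λ () }) e) g-at) ⟩
      Σᶠ g + 2                                    ≡⟨ weight-g ⟩
      Σᶠ f + (count (private-nbr v) + 1)          ≡⟨ cong (Σᶠ f +_) (+-comm _ 1) ⟩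
      Σᶠ f + suc (count (private-nbr v))          ≡⟨ +-suc (Σᶠ f) _ ⟩
      suc (Σᶠ f + count (private-nbr v))          ∎))
    where
    open ≤-Reasoning
    open Release v fv 1 ≤-refl

  private-count : ∀ v → f v ≡ 2 → count (private-nbr v) ≡ 2
  private-count v fv = ≤-antisym (private-≤2 v fv) (private-≥2 v fv)

  -- Here v can be set to 0, as w dominates it; with its two private neighbours set to 1 the weight is unchanged.
  no-pendant-two : ∀ {v w} → f v ≡ 2 → Adj G v w → f w ≡ 2 → ¬ (∀ z → Adj G v z → f z ≡ 2 → z ≡ w)
  no-pendant-two {v} {w} fv vw fw only with count≡2⇒ _ (private-count v fv)
  -- The private neighbour `c` has received the value 1, so `one` makes the weight strictly larger.
  ... | c , _ , _ , pc , _ = <-irrefl (sym weight-same) (one g c (bounded , dom) (g-nbr (proj₁ (private-nbr⇒ pc)) (proj₂ (private-nbr⇒ pc))))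
    where
    open Release v fv 0 z≤n
    dom : ∀ u → g u ≡ 0 → Dominated G g u
    dom u e = case u ≟ v of λ
      { (yes refl) → w , (vw , g-two (irrefl (symm vw)) fw) , λ z vz z2 → only z vz (proj₂ (g-two⁻ z z2))
      ; (no u≢v) → dominated u u≢v e }
    weight-same : Σᶠ g ≡ Σᶠ f
    weight-same = +-cancelʳ-≡ 2 _ _ (trans weight-g (cong (Σᶠ f +_) (trans (+-identityʳ _) (private-count v fv))))

  -- By `no-pendant-two` at `b` there is a further neighbour `c` with value 2, and the argument
  -- repeats on the edge from `b` to `c`, whose branch is smaller.
  no-adjacent-twos : ∀ k {a b} → size a b < k → Adj G a b → f a ≡ 2 → f b ≢ 2
  no-adjacent-twos (suc k) {a} {b} lt ab fa fb
    with any? (λ c → (G b c Bool.≟ true) ×-dec (¬? (c ≟ a) ×-dec (f c ℕ.≟ 2)))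
  ... | yes (c , bc , c≢a , fc) = no-adjacent-twos k (<-≤-trans (size-< ab bc c≢a) (ℕ.s≤s⁻¹ lt)) bc fb fc
  ... | no none = no-pendant-two fb (symm ab) fa λ z bz fz → case z ≟ a of λ
      { (yes e) → e ; (no ne) → ⊥-elim (none (z , bz , ne , fz)) }

  nbr-of-two : ∀ {v x} → f v ≡ 2 → Adj G v x → f x ≡ 0
  nbr-of-two {v} {x} fv vx with f-values x
  ... | inj₁ e = e
  ... | inj₂ e = ⊥-elim (no-adjacent-twos _ ≤-refl vx fv e)

  -- All neighbours of a 2 are now known to be zeros, hence private, and there are exactly two
  -- private ones.
  ends : ∀ v → f v ≡ 2 → ∃ λ b → ∃ λ d → b ≢ d × Adj G v b × Adj G v d × (∀ w → Adj G v w → w ≡ b ⊎ w ≡ d)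
  ends v fv with count≡2⇒ _ (private-count v fv)
  ... | b , d , b≢d , pb , pd , all = b , d , b≢d , proj₁ (private-nbr⇒ pb) , proj₁ (private-nbr⇒ pd) ,
    λ w vw → all w (private-nbr⇐ vw (nbr-of-two fv vw))

  other-end : ∀ v {b} → f v ≡ 2 → Adj G v b → ∃ λ d → b ≢ d × Adj G v d × (∀ w → Adj G v w → w ≡ b ⊎ w ≡ d)
  other-end v fv vb with ends v fv
  ... | x , y , x≢y , vx , vy , all with all _ vb
  ...   | inj₁ refl = y , x≢y , vy , all
  ...   | inj₂ refl = x , x≢y ∘ sym , vx , λ w vw → [ inj₂ , inj₁ ]′ (all w vw)

  centre-unique : ∀ {b v w} → Adj G v b → f v ≡ 2 → Adj G b w → f w ≡ 2 → w ≡ v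
  centre-unique {b} {v} {w} vb fv bw fw with proj₂ pr b (nbr-of-two fv vb)
  ... | _ , _ , uniq = trans (uniq w bw fw) (sym (uniq v (symm vb) fv))

  -- The result of the operation seen inside the tree: `b`, `c`, `d` are v₃, v₂, v₁, and `a` is the
  -- vertex `u` of attachment.
  record Pendant : Set where
    field
      a b c d : Fin n
      ab : Adj G a b
      bc : Adj G b c
      cd : Adj G c d
      fc : f c ≡ 2
      fa : f a ≡ 0
      b≢d : b ≢ d
      nbr-b : ∀ w → Adj G b w → w ≡ a ⊎ w ≡ c
      nbr-c : ∀ w → Adj G c w → w ≡ b ⊎ w ≡ d
      nbr-d : ∀ w → Adj G d w → w ≡ c

  other? : ∀ b (x y : Fin n) → Dec (∃ λ w → Adj G b w × w ≢ x × w ≢ y)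
  other? b x y = any? λ w → (G b w Bool.≟ true) ×-dec (¬? (w ≟ x) ×-dec ¬? (w ≟ y))

  -- The copy `b`, `c`, `d` lies beyond `a`. A further neighbour of `b` or `d` is again a zero,
  -- because `c` is their only dominator, so the search continues along an edge into a smaller
  -- branch.
  pendant : ∀ k {a b} → size a b < k → Adj G a b → f a ≡ 0 → f b ≡ 0 → Pendant
  pendant (suc k) {a} {b} lt ab fa fb with proj₂ pr b fb
  ... | c , (bc , fc) , uniq with other-end c fc (symm bc)
  ...   | d , b≢d , cd , all with other? b a c | other? d c c
  ...     | yes (e , be , e≢a , e≢c) | _ =
            pendant k (<-≤-trans (size-< ab be e≢a) (ℕ.s≤s⁻¹ lt)) be fb ([ id , (λ e2 → ⊥-elim (e≢c (uniq e be e2))) ]′ (f-values e))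
  ...     | no _ | yes (e , de , e≢c , _) =
            pendant k (<-trans (size-< cd de e≢c) (<-trans (size-< bc cd (b≢d ∘ sym)) (<-≤-trans (size-< ab bc c≢a) (ℕ.s≤s⁻¹ lt)))) de (nbr-of-two fc cd)
              ([ id , (λ e2 → ⊥-elim (e≢c (centre-unique cd fc de e2))) ]′ (f-values e))
            where
            c≢a : c ≢ a
            c≢a refl = f-not-both fa fc
  ...     | no nb | no nd = record { ab = ab ; bc = bc ; cd = cd ; fc = fc ; fa = fa ; b≢d = b≢d
              ; nbr-b = λ w bw → decide (w ≟ a) (w ≟ c) λ wa wc → nb (w , bw , wa , wc)
              ; nbr-c = all
              ; nbr-d = λ w dw → [ id , id ]′ (decide (w ≟ c) (w ≟ c) λ wc _ → nd (w , dw , wc , wc)) }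
            where
            decide : ∀ {P Q : Set} → Dec P → Dec Q → (¬ P → ¬ Q → ⊥) → P ⊎ Q
            decide (yes p) _ _ = inj₁ p
            decide (no _) (yes q) _ = inj₂ q
            decide (no p) (no q) r = ⊥-elim (r p q)

  record Single : Set where
    field
      b c d : Fin n
      bc : Adj G b c
      cd : Adj G c d
      b≢d : b ≢ d
      nbr-b : ∀ w → Adj G b w → w ≡ c
      nbr-c : ∀ w → Adj G c w → w ≡ b ⊎ w ≡ d
      nbr-d : ∀ w → Adj G d w → w ≡ c

  -- Any vertex leads to some copy of P₃. If an edge leaves the copy towards `e`, this edge, read
  -- from `e` into the copy, joins two zeros and starts the descent.
  single-or-pendant : Fin n → Single ⊎ Pendant
  single-or-pendant x = at-centre (centre (f-values x))
    where
    centre : f x ≡ 0 ⊎ f x ≡ 2 → ∃ λ c → f c ≡ 2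
    centre (inj₂ e) = x , e
    centre (inj₁ e) = let (c , (_ , fc) , _) = proj₂ pr x e in c , fc
    at-centre : (∃ λ c → f c ≡ 2) → Single ⊎ Pendant
    at-centre (c , fc) with ends c fc
    ... | b , d , b≢d , cb , cd , all with other? b c c | other? d c c
    ...   | yes (e , be , e≢c , _) | _ = inj₂ (pendant _ ≤-refl (symm be)
              ([ id , (λ e2 → ⊥-elim (e≢c (centre-unique cb fc be e2))) ]′ (f-values e)) (nbr-of-two fc cb))
    ...   | no _ | yes (e , de , e≢c , _) = inj₂ (pendant _ ≤-refl (symm de)
              ([ id , (λ e2 → ⊥-elim (e≢c (centre-unique cd fc de e2))) ]′ (f-values e)) (nbr-of-two fc cd))
    ...   | no nb | no nd = inj₁ record { bc = symm cb ; cd = cd ; b≢d = b≢d ; nbr-c = all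
              ; nbr-b = λ w bw → decidable-stable (w ≟ c) λ ne → nb (w , bw , ne , ne)
              ; nbr-d = λ w dw → decidable-stable (w ≟ c) λ ne → nd (w , dw , ne , ne) }

-- Removing a pendant P₃

-- Edges may be contracted, as is needed when a removed path is collapsed to a vertex.
Reach-map : ∀ {m} {G : Graph n} {H : Graph m} (φ : Fin n → Fin m) →
  (∀ {u v} → Adj G u v → φ u ≡ φ v ⊎ Adj H (φ u) (φ v)) → ∀ {u v} → Reach G u v → Reach H (φ u) (φ v)
Reach-map φ φ-adj here = here
Reach-map {H = H} φ φ-adj {_} {w} (step a r) with φ-adj a
... | inj₁ e  = subst (λ x → Reach H x (φ w)) (sym e) (Reach-map φ φ-adj r)
... | inj₂ a′ = step a′ (Reach-map φ φ-adj r)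

HasCycle-map : ∀ {m} {G : Graph n} {H : Graph m} (φ : Fin n → Fin m) → (∀ {u v} → φ u ≡ φ v → u ≡ v) →
  (∀ {u v} → Adj G u v → Adj H (φ u) (φ v)) → HasCycle G → HasCycle H
HasCycle-map {H = H} φ inj φ-adj (x , vs , l , uniq , linked) =
  φ x , map φ vs , subst (2 ≤_) (sym (length-map φ vs)) l , Uniqueₚ.map⁺ inj uniq ,
  subst (λ ws → Linked (Adj H) (φ x ∷ ws)) (map-++ φ vs (x ∷ [])) (Linkedₚ.map⁺ (Linked.map φ-adj linked))

⟨$⟩ʳ-injective : (σ : Permutation′ n) → ∀ {i j} → σ ⟨$⟩ʳ i ≡ σ ⟨$⟩ʳ j → i ≡ j
⟨$⟩ʳ-injective σ e = trans (sym (inverseˡ σ)) (trans (cong (σ ⟨$⟩ˡ_) e) (inverseˡ σ))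

≅-tree : G ≅ H → IsTree H → IsTree G
≅-tree {G = G} {H} (σ , e) ((symH , irrH) , conn , acyclic) =
  ((λ u v → trans (sym (e u v)) (trans (symH _ _) (e v u))) , λ u → trans (sym (e u u)) (irrH _)) ,
  (λ u v → subst₂ (Reach G) (inverseˡ σ) (inverseˡ σ)
    (Reach-map (σ ⟨$⟩ˡ_) (λ a → inj₂ (trans (sym (e _ _)) (trans (cong₂ H (inverseʳ σ) (inverseʳ σ)) a))) (conn (σ ⟨$⟩ʳ u) (σ ⟨$⟩ʳ v)))) ,
  λ c → acyclic (HasCycle-map (σ ⟨$⟩ʳ_) (⟨$⟩ʳ-injective σ) (λ {u} {v} a → trans (e u v) a) c)

≅-trans : {K : Graph n} → G ≅ H → H ≅ K → G ≅ K
≅-trans (σ , e) (τ , e′) = σ ∘ₚ τ , λ i j → trans (e′ _ _) (e i j)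

-- Collapsing the path onto `u` turns walks of the large tree into walks of `G`, and a cycle of `G`
-- is one of the large tree.
O1-tree : (G : Graph n) (u : Fin n) → IsTree (O1 G u) → IsTree G
O1-tree {n} G u ((symT , irrT) , conn , acyclic) =
  ((λ v w → symT (old v) (old w)) , λ v → irrT (old v)) ,
  (λ v w → Reach-map collapse (λ {x} {y} → collapse-adj x y) (conn (old v) (old w))) ,
  λ c → acyclic (HasCycle-map old (suc-injective ∘ suc-injective ∘ suc-injective) id c)
  where
  collapse : Fin (3 + n) → Fin n
  collapse (suc (suc (suc v))) = v
  collapse _ = u
  collapse-adj : ∀ v w → Adj (O1 G u) v w → collapse v ≡ collapse w ⊎ Adj G (collapse v) (collapse w)
  collapse-adj zero zero _ = inj₁ refl
  collapse-adj zero (suc zero) _ = inj₁ refl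
  collapse-adj zero (suc (suc zero)) _ = inj₁ refl
  collapse-adj zero (suc (suc (suc w))) a = inj₁ (sym (≡-adj a))
  collapse-adj (suc zero) zero _ = inj₁ refl
  collapse-adj (suc zero) (suc zero) _ = inj₁ refl
  collapse-adj (suc zero) (suc (suc zero)) _ = inj₁ refl
  collapse-adj (suc zero) (suc (suc (suc w))) ()
  collapse-adj (suc (suc zero)) zero _ = inj₁ refl
  collapse-adj (suc (suc zero)) (suc zero) _ = inj₁ refl
  collapse-adj (suc (suc zero)) (suc (suc zero)) _ = inj₁ refl
  collapse-adj (suc (suc zero)) (suc (suc (suc w))) ()
  collapse-adj (suc (suc (suc v))) zero a = inj₁ (≡-adj a)
  collapse-adj (suc (suc (suc v))) (suc zero) ()
  collapse-adj (suc (suc (suc v))) (suc (suc zero)) ()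
  collapse-adj (suc (suc (suc v))) (suc (suc (suc w))) a = inj₂ a

module Reduction {n} (G : Graph n) (u : Fin n) (tree : IsTree (O1 G u)) (S : Stab (O1 G u))
  (fc : Stab.f S (suc zero) ≡ 2) where

  open O₁ G u
  open Stab S
  open Structure T tree S
  open Stable T tree S using (two-at-zero; f-values)

  f₀ : f zero ≡ 0
  f₀ = nbr-of-two fc refl

  f₂ : f (suc (suc zero)) ≡ 0
  f₂ = nbr-of-two fc refl

  fu : f (old u) ≡ 0
  fu = [ id , (λ e → case centre-unique {zero} {suc zero} {old u} refl fc (adj-refl u) e of λ ()) ]′ (f-values (old u))

  f≡2+ : Σᶠ f ≡ 2 + Σᶠ (f ∘ old)
  f≡2+ rewrite fc | f₀ | f₂ = refl

  -- Extended by 0, 2, 0, such a `g` is not a PRDF, as v₃ has two dominators. But v₃ is a neighbour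
  -- of `u`, and `two-at-zero` asks nothing of the neighbours of the vertex.
  two-at-u : ∀ g → PR G g → g u ≡ 2 → Σᶠ (f ∘ old) < Σᶠ g
  two-at-u g (b , d) gu = +-cancelˡ-< 2 _ _ (subst (_< 2 + Σᶠ g) f≡2+ (two-at-zero (old u) (0 ▸ 2 ▸ 0 ▸ g) fu bnd gu dom))
    where
    bnd : Bounded (0 ▸ 2 ▸ 0 ▸ g)
    bnd zero = z≤n
    bnd (suc zero) = ≤-refl
    bnd (suc (suc zero)) = z≤n
    bnd (suc (suc (suc x))) = b x
    dom : ∀ x → (0 ▸ 2 ▸ 0 ▸ g) x ≡ 0 → ¬ Adj T (old u) x → Dominated T (0 ▸ 2 ▸ 0 ▸ g) x
    dom zero _ na = ⊥-elim (na (adj-refl u))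
    dom (suc (suc zero)) _ _ = centre-dominates₂
    dom (suc (suc (suc x))) e _ = extend-dominated (inj₂ λ ()) (d x e)

  extend : ∀ g → PR G g → g u ≢ 2 → PR T (0 ▸ 2 ▸ 0 ▸ g)
  extend g = extend-centre 0 0 z≤n z≤n

  one′ : ∀ g x → PR G g → g x ≡ 1 → Σᶠ (f ∘ old) < Σᶠ g
  one′ g x gp gx with g u ℕ.≟ 2
  ... | yes gu = two-at-u g gp gu
  ... | no g≢2 = +-cancelˡ-< 2 _ _ (subst (_< 2 + Σᶠ g) f≡2+ (one _ (old x) (extend g gp g≢2) gx))

  min′ : ∀ g → PR G g → Σᶠ (f ∘ old) ≤ Σᶠ g
  min′ g gp with g u ℕ.≟ 2
  ... | yes gu = <⇒≤ (two-at-u g gp gu)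
  ... | no g≢2 = +-cancelˡ-≤ 2 _ _ (subst (_≤ 2 + Σᶠ g) f≡2+ (min _ (extend g gp g≢2)))

  restrict-≤ : ∀ h j → Σᶠ h ≡ suc (Σᶠ f) → j ≤ path h → j + Σᶠ (h ∘ old) ≤ 3 + Σᶠ (f ∘ old)
  restrict-≤ h j hw l = ≤-trans (+-monoˡ-≤ _ l) (≤-reflexive (trans (sym (Σᶠ-split h)) (trans hw (cong suc f≡2+))))

  -- A witness for the large tree is restricted. The path uses at least 2, and 3 if v₃ dominates
  -- `u`; this pays for raising `u` to 1. The value 1 at `x` survives, so `one′` gives the opposite
  -- bound.
  ex′ : ∀ x → ∃ λ h → PR G h × h x ≡ 1 × Σᶠ h ≡ suc (Σᶠ (f ∘ old))
  ex′ x with ex (old x)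
  ... | h , hp , hx , hw with cases h
  ...   | inj₁ c = h ∘ old , restrict-PR hp c , hx ,
            ≤-antisym (+-cancelˡ-≤ 2 _ _ (≤-trans (restrict-≤ h 2 hw (path-≥2 h hp)) ≤-refl)) (one′ _ x (restrict-PR hp c) hx)
  ...   | inj₂ (h₀ , hu) = h′ , hp′ , h′x ,
            ≤-antisym (≤-trans (≤-reflexive (Σᶠ-raise {f = h ∘ old} u hu)) (s≤s (+-cancelˡ-≤ 3 _ _ (restrict-≤ h 3 hw (path-≥3 h hp h₀))))) (one′ h′ x hp′ h′x)
    where
    h′ = upd u 1 (h ∘ old)
    hp′ = raise-PR hp hu
    h′x : h′ x ≡ 1
    h′x = trans (upd-other {p = u} {a = 1} {h ∘ old} λ { refl → case trans (sym hu) hx of λ () }) hx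

  reduced : Stab G
  reduced = record { f = f ∘ old ; pr = restrict-PR pr (inj₁ λ e → case trans (sym f₀) e of λ ()) ; min = min′ ; one = one′ ; ex = ex′ }

  -- Both other values at `u` push the weight above the minimum: 1 by `one′` and 2 by `two-at-u`.
  inW : InW G u
  inW g (gp , gmin) = by (g u) refl (proj₁ gp u)
    where
    gp′ = IsPRDF⇒PR {G = G} gp
    not-above : ¬ (Σᶠ (f ∘ old) < Σᶠ g)
    not-above l = <-irrefl refl (<-≤-trans l (gmin _ (PR⇒IsPRDF {G = G} (Stab.pr reduced))))
    by : ∀ a → g u ≡ a → a ≤ 2 → g u ≡ 0
    by 0 e _ = e
    by 1 e _ = ⊥-elim (not-above (one′ g u gp′ e))
    by 2 e _ = ⊥-elim (not-above (two-at-u g gp′ e))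
    by (suc (suc (suc _))) e (s≤s (s≤s ()))

-- Identifying the tree with a member of the family

bool-ext : ∀ {x y : Bool} → (x ≡ true → y ≡ true) → (y ≡ true → x ≡ true) → x ≡ y
bool-ext {false} {false} _ _ = refl
bool-ext {false} {true}  _ g = g refl
bool-ext {true}  {y}     f _ = sym (f refl)

≢true : ∀ {x} → ¬ (x ≡ true) → x ≡ false
≢true na = bool-ext (⊥-elim ∘ na) λ ()

O1-≅ : ((τ , _) : G ≅ H) (u : Fin n) → O1 G (τ ⟨$⟩ˡ u) ≅ O1 H u
O1-≅ {G = G} {H} (τ , e) u = lift₀ (lift₀ (lift₀ τ)) , iso
  where
  attached : ∀ i → ⌊ u ≟ τ ⟨$⟩ʳ i ⌋ ≡ ⌊ τ ⟨$⟩ˡ u ≟ i ⌋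
  attached i = bool-ext
    (λ a → subst (λ j → ⌊ τ ⟨$⟩ˡ u ≟ j ⌋ ≡ true) (trans (cong (τ ⟨$⟩ˡ_) (sym (≡-adj a))) (inverseˡ τ)) (adj-refl _))
    (λ a → subst (λ j → ⌊ u ≟ j ⌋ ≡ true) (trans (sym (inverseʳ τ)) (cong (τ ⟨$⟩ʳ_) (sym (≡-adj a)))) (adj-refl u))
  σ = lift₀ (lift₀ (lift₀ τ))
  iso : ∀ i j → O1 H u (σ ⟨$⟩ʳ i) (σ ⟨$⟩ʳ j) ≡ O1 G (τ ⟨$⟩ˡ u) i j
  iso zero zero = refl
  iso zero (suc zero) = refl
  iso zero (suc (suc zero)) = refl
  iso zero (suc (suc (suc j))) = attached j
  iso (suc zero) zero = refl
  iso (suc zero) (suc zero) = refl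
  iso (suc zero) (suc (suc zero)) = refl
  iso (suc zero) (suc (suc (suc j))) = refl
  iso (suc (suc zero)) zero = refl
  iso (suc (suc zero)) (suc zero) = refl
  iso (suc (suc zero)) (suc (suc zero)) = refl
  iso (suc (suc zero)) (suc (suc (suc j))) = refl
  iso (suc (suc (suc i))) zero = attached i
  iso (suc (suc (suc i))) (suc zero) = refl
  iso (suc (suc (suc i))) (suc (suc zero)) = refl
  iso (suc (suc (suc i))) (suc (suc (suc j))) = e i j

≅-InW : ((τ , _) : G ≅ H) {u : Fin n} → InW H u → InW G (τ ⟨$⟩ˡ u)
≅-InW {G = G} {H} i@(τ , _) w g (gp , gmin) = w _
  ( PR⇒IsPRDF {G = H} (≅-PR (≅-sym {G = G} i) (IsPRDF⇒PR {G = G} gp))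
  , λ h hp → ≤-trans (≤-reflexive (Σᶠ-permute g (flip τ)))
      (≤-trans (gmin _ (PR⇒IsPRDF {G = G} (≅-PR i (IsPRDF⇒PR {G = H} hp)))) (≤-reflexive (Σᶠ-permute h τ))) )

three : ∀ n {b c d : Fin n} → b ≢ c → c ≢ d → b ≢ d → ∃ λ k → n ≡ 3 + k
three 1 {zero} {zero} bc _ _ = ⊥-elim (bc refl)
three 2 {zero} {zero} bc _ _ = ⊥-elim (bc refl)
three 2 {suc zero} {suc zero} bc _ _ = ⊥-elim (bc refl)
three 2 {zero} {suc zero} {zero} _ _ bd = ⊥-elim (bd refl)
three 2 {zero} {suc zero} {suc zero} _ cd _ = ⊥-elim (cd refl)
three 2 {suc zero} {zero} {zero} _ cd _ = ⊥-elim (cd refl)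
three 2 {suc zero} {zero} {suc zero} _ _ bd = ⊥-elim (bd refl)
three (suc (suc (suc k))) _ _ _ = k , refl

-- The indices 0, 1, 2 are those that `O1` gives to v₃, v₂, v₁. Three insertions each choose the
-- image of the first remaining index.
relabel : ∀ {k} {b c d : Fin (3 + k)} → b ≢ c → c ≢ d → b ≢ d → Σ (Permutation′ (3 + k)) λ σ →
  σ ⟨$⟩ʳ zero ≡ b × σ ⟨$⟩ʳ suc zero ≡ c × σ ⟨$⟩ʳ suc (suc zero) ≡ d
relabel {k} {b} {c} {d} b≢c c≢d b≢d = σ₀ , refl ,
  trans (insert-punchIn zero b σ₁ zero) (punchIn-punchOut b≢c) ,
  trans (insert-punchIn zero b σ₁ (suc zero))
    (trans (cong (punchIn b) (trans (insert-punchIn zero c′ σ₂ zero) (punchIn-punchOut c′≢d′))) (punchIn-punchOut b≢d))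
  where
  c′ = punchOut b≢c
  d′ = punchOut b≢d
  c′≢d′ : c′ ≢ d′
  c′≢d′ e = c≢d (trans (sym (punchIn-punchOut b≢c)) (trans (cong (punchIn b) e) (punchIn-punchOut b≢d)))
  σ₂ : Permutation′ (suc k)
  σ₂ = insert zero (punchOut c′≢d′) Perm.id
  σ₁ : Permutation′ (2 + k)
  σ₁ = insert zero c′ σ₂
  σ₀ : Permutation′ (3 + k)
  σ₀ = insert zero b σ₁

-- Only `b` can have a neighbour outside the copy; the two inner modules treat the case of one such
-- neighbour and the case of none.
module Assemble {k} (T : Graph (3 + k)) (tree : IsTree T) (σ : Permutation′ (3 + k))
  (bc : Adj T (σ ⟨$⟩ʳ zero) (σ ⟨$⟩ʳ suc zero)) (cd : Adj T (σ ⟨$⟩ʳ suc zero) (σ ⟨$⟩ʳ suc (suc zero)))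
  (nbr-c : ∀ w → Adj T (σ ⟨$⟩ʳ suc zero) w → w ≡ σ ⟨$⟩ʳ zero ⊎ w ≡ σ ⟨$⟩ʳ suc (suc zero))
  (nbr-d : ∀ w → Adj T (σ ⟨$⟩ʳ suc (suc zero)) w → w ≡ σ ⟨$⟩ʳ suc zero) where

  b c d : Fin (3 + k)
  b = σ ⟨$⟩ʳ zero
  c = σ ⟨$⟩ʳ suc zero
  d = σ ⟨$⟩ʳ suc (suc zero)

  open Branches T tree

  inj : ∀ {i j} → σ ⟨$⟩ʳ i ≡ σ ⟨$⟩ʳ j → i ≡ j
  inj = ⟨$⟩ʳ-injective σ

  loop : ∀ i → T (σ ⟨$⟩ʳ i) (σ ⟨$⟩ʳ i) ≡ false
  loop i = proj₂ (proj₁ tree) _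

  cb : Adj T c b
  cb = symm bc

  dc : Adj T d c
  dc = symm cd

  db : T d b ≡ false
  db = ≢true λ a → case inj (nbr-d _ a) of λ ()

  bd : T b d ≡ false
  bd = trans (proj₁ (proj₁ tree) b d) db

  c-old : ∀ i → T c (σ ⟨$⟩ʳ old i) ≡ false
  c-old i = ≢true λ a → [ (λ e → case inj e of λ ()) , (λ e → case inj e of λ ()) ]′ (nbr-c _ a)

  d-old : ∀ i → T d (σ ⟨$⟩ʳ old i) ≡ false
  d-old i = ≢true λ a → case inj (nbr-d _ a) of λ ()

  module _ (u : Fin k) (nbr-b : ∀ w → Adj T b w → w ≡ σ ⟨$⟩ʳ old u ⊎ w ≡ c) (ub : Adj T (σ ⟨$⟩ʳ old u) b) where

    rest : Graph k
    rest i j = T (σ ⟨$⟩ʳ old i) (σ ⟨$⟩ʳ old j)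

    b-old : ∀ i → T b (σ ⟨$⟩ʳ old i) ≡ ⌊ u ≟ i ⌋
    b-old i = bool-ext
      (λ a → [ (λ e → subst (λ j → ⌊ u ≟ j ⌋ ≡ true) (sym (suc-injective (suc-injective (suc-injective (inj e))))) (adj-refl u))
             , (λ e → case inj e of λ ()) ]′ (nbr-b _ a))
      (λ a → subst (λ j → T b (σ ⟨$⟩ʳ old j) ≡ true) (sym (≡-adj a)) (symm ub))

    rest-≅ : O1 rest u ≅ T
    rest-≅ = σ , iso
      where
      iso : ∀ i j → T (σ ⟨$⟩ʳ i) (σ ⟨$⟩ʳ j) ≡ O1 rest u i j
      iso zero zero = loop zero
      iso zero (suc zero) = bc
      iso zero (suc (suc zero)) = bd
      iso zero (suc (suc (suc j))) = b-old j
      iso (suc zero) zero = cb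
      iso (suc zero) (suc zero) = loop (suc zero)
      iso (suc zero) (suc (suc zero)) = cd
      iso (suc zero) (suc (suc (suc j))) = c-old j
      iso (suc (suc zero)) zero = db
      iso (suc (suc zero)) (suc zero) = dc
      iso (suc (suc zero)) (suc (suc zero)) = loop (suc (suc zero))
      iso (suc (suc zero)) (suc (suc (suc j))) = d-old j
      iso (suc (suc (suc i))) zero = trans (proj₁ (proj₁ tree) _ _) (b-old i)
      iso (suc (suc (suc i))) (suc zero) = trans (proj₁ (proj₁ tree) _ _) (c-old i)
      iso (suc (suc (suc i))) (suc (suc zero)) = trans (proj₁ (proj₁ tree) _ _) (d-old i)
      iso (suc (suc (suc i))) (suc (suc (suc j))) = refl

  module _ (nbr-b : ∀ w → Adj T b w → w ≡ c) where

    Here : Fin (3 + k) → Set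
    Here x = x ≡ b ⊎ x ≡ c ⊎ x ≡ d

    -- A walk cannot leave a copy of P₃ without outside neighbours, so connectedness leaves no room
    -- for other vertices.
    closed : ∀ {x y} → Here x → Reach T x y → Here y
    closed h here = h
    closed (inj₁ refl)        (step a r) = closed (inj₂ (inj₁ (nbr-b _ a))) r
    closed (inj₂ (inj₁ refl)) (step a r) = closed ([ inj₁ , inj₂ ∘ inj₂ ]′ (nbr-c _ a)) r
    closed (inj₂ (inj₂ refl)) (step a r) = closed (inj₂ (inj₁ (nbr-d _ a))) r

    no-rest : Fin k → ⊥
    no-rest i with closed (inj₁ refl) (proj₁ (proj₂ tree) b (σ ⟨$⟩ʳ old i))
    ... | inj₁ e        = case inj e of λ ()
    ... | inj₂ (inj₁ e) = case inj e of λ ()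
    ... | inj₂ (inj₂ e) = case inj e of λ ()

P3-only : ∀ k (T : Graph (3 + k)) → IsTree T → (σ : Permutation′ (3 + k)) →
  let b = σ ⟨$⟩ʳ zero ; c = σ ⟨$⟩ʳ suc zero ; d = σ ⟨$⟩ʳ suc (suc zero) in
  Adj T b c → Adj T c d → (∀ w → Adj T b w → w ≡ c) → (∀ w → Adj T c w → w ≡ b ⊎ w ≡ d) → (∀ w → Adj T d w → w ≡ c) → In𝒯 T
P3-only (suc k) T tree σ bc cd nbr-b nbr-c nbr-d = ⊥-elim (no-rest nbr-b zero)
  where open Assemble T tree σ bc cd nbr-c nbr-d
P3-only zero T tree σ bc cd nbr-b nbr-c nbr-d = P3 , base , σ , iso
  where
  open Assemble T tree σ bc cd nbr-c nbr-d
  iso : ∀ i j → T (σ ⟨$⟩ʳ i) (σ ⟨$⟩ʳ j) ≡ P3 i j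
  iso zero zero = loop zero
  iso zero (suc zero) = bc
  iso zero (suc (suc zero)) = bd
  iso (suc zero) zero = cb
  iso (suc zero) (suc zero) = loop (suc zero)
  iso (suc zero) (suc (suc zero)) = cd
  iso (suc (suc zero)) zero = db
  iso (suc (suc zero)) (suc zero) = dc
  iso (suc (suc zero)) (suc (suc zero)) = loop (suc (suc zero))

In𝒯-single : (T : Graph n) → IsTree T → ∀ {b c d} → b ≢ c → c ≢ d → b ≢ d → Adj T b c → Adj T c d →
  (∀ w → Adj T b w → w ≡ c) → (∀ w → Adj T c w → w ≡ b ⊎ w ≡ d) → (∀ w → Adj T d w → w ≡ c) → In𝒯 T
In𝒯-single {n} T tree b≢c c≢d b≢d bc cd nbr-b nbr-c nbr-d with three n b≢c c≢d b≢d
... | k , refl with relabel b≢c c≢d b≢d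
...   | σ , refl , refl , refl = P3-only k T tree σ bc cd nbr-b nbr-c nbr-d

In𝒯-O1 : (G : Graph n) (u : Fin n) {T : Graph (3 + n)} → O1 G u ≅ T → InW G u → In𝒯 G → In𝒯 T
In𝒯-O1 G u {T} iso w (G₀ , gen , τ@(t , _)) = O1 G₀ (t ⟨$⟩ˡ u) , op gen _ (≅-InW {G = G₀} {H = G} τ w) , ≅-trans {G = O1 G₀ (t ⟨$⟩ˡ u)} {H = O1 G u} {K = T} (O1-≅ {G = G₀} {H = G} τ u) iso

old-index : (i : Fin (3 + n)) → i ≢ zero → i ≢ suc zero → i ≢ suc (suc zero) → ∃ λ u → i ≡ old u
old-index zero p _ _ = ⊥-elim (p refl)
old-index (suc zero) _ p _ = ⊥-elim (p refl)
old-index (suc (suc zero)) _ _ p = ⊥-elim (p refl)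
old-index (suc (suc (suc u))) _ _ _ = u , refl

In𝒯-pendant : (T : Graph n) (tree : IsTree T) (S : Stab T) → Structure.Pendant T tree S →
  (∀ {m} (G : Graph m) → m < n → IsTree G → Stab G → Fin m → In𝒯 G) → In𝒯 T
In𝒯-pendant {n} T tree S P rec = relabelled (λ { refl → case trans (sym fa) fc of λ () }) ab bc cd fc b≢d nbr-b nbr-c nbr-d
  where
  open Branches T tree
  open Structure T tree S
  open Pendant P
  -- The four vertices are quantified anew, so that matching can identify them with values of `σ`.
  relabelled : ∀ {a b c d} → a ≢ c → Adj T a b → Adj T b c → Adj T c d → Stab.f S c ≡ 2 → b ≢ d →
    (∀ w → Adj T b w → w ≡ a ⊎ w ≡ c) → (∀ w → Adj T c w → w ≡ b ⊎ w ≡ d) → (∀ w → Adj T d w → w ≡ c) → In𝒯 T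
  relabelled a≢c ab bc cd fc b≢d nbr-b nbr-c nbr-d with three n (irrefl bc) (irrefl cd) b≢d
  ... | k , refl with relabel (irrefl bc) (irrefl cd) b≢d
  relabelled {a} a≢c ab bc cd fc b≢d nbr-b nbr-c nbr-d | k , refl | σ , refl , refl , refl =
    attach (old-index (σ ⟨$⟩ˡ a) (λ e → irrefl ab (back e)) (λ e → a≢c (back e)) (λ e → irrefl bc (nbr-d _ (subst (λ x → Adj T x _) (back e) ab))))
    where
    back : ∀ {i} → σ ⟨$⟩ˡ a ≡ i → a ≡ σ ⟨$⟩ʳ i
    back e = trans (sym (inverseʳ σ)) (cong (σ ⟨$⟩ʳ_) e)
    attach : (∃ λ u → σ ⟨$⟩ˡ a ≡ old u) → In𝒯 T
    attach (u , e) with back e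
    ... | refl = In𝒯-O1 rest′ u {T} iso inW (rec rest′ (m≤n+m (suc k) 2) (O1-tree rest′ u tree′) reduced u)
      where
      open Assemble T tree σ bc cd nbr-c nbr-d
      rest′ = rest u nbr-b ab
      iso : O1 rest′ u ≅ T
      iso = rest-≅ u nbr-b ab
      tree′ : IsTree (O1 rest′ u)
      tree′ = ≅-tree {G = O1 rest′ u} {H = T} iso tree
      open Reduction rest′ u tree′ (≅-Stab (≅-sym {G = O1 rest′ u} {H = T} iso) S) fc

-- Strong induction on the order through the bound `N`. The vertex `x` shows that the tree is not
-- empty; in the recursive call it is the vertex of attachment.
stable-In𝒯 : ∀ N {n} (T : Graph n) → n < N → IsTree T → Stab T → Fin n → In𝒯 T
stable-In𝒯 (suc N) T n<N tree S x with Structure.single-or-pendant T tree S x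
... | inj₁ s = In𝒯-single T tree (irrefl bc) (irrefl cd) b≢d bc cd nbr-b nbr-c nbr-d
  where
  open Branches T tree
  open Structure.Single s
... | inj₂ p = In𝒯-pendant T tree S p λ G m<n → stable-In𝒯 N G (<-≤-trans m<n (ℕ.s≤s⁻¹ n<N))

theorem1 : ∀ (m : ℕ) (T : Graph (suc m)) → 3 ≤ suc m → IsTree T →
    (IsPRDStable T → In𝒯 T) × (In𝒯 T → IsPRDStable T)
theorem1 m T _ tree =
  (λ stable → stable-In𝒯 _ T ≤-refl tree (stable⇒Stab {G = T} stable) zero) ,
  λ (G , gen , iso) → Stab⇒stable {G = T} (≅-Stab {G = G} iso (Rigid⇒Stab (Gen⇒Rigid gen)))
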